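{- Let $n$ be a positive integer and let $G$ be a simple graph. Then $G$ is isomorphic to the quadrilateral book graph $B_{n,2}$ if and only if all of the following hold: $$[x]\,da(G;x,y) = 2y^{n+1} + 2n\,y^{2n},$$ $$[x^{2}]\,da(G;x,y) = n\,y^{2n+2} + (2n+1)y^{n+3},$$ $$[x^{2n+1}]\,da(G;x,y) = (2n+2)y^{2n+2},$$ $$[x^{2n+2}]\,da(G;x,y) = y^{2n+4}.$$
   Context: All graphs are finite, simple and have at least one vertex. For a graph $G$, $S\subseteq V(G)$ and $u\in V(G)$, let $\bar S=V(G)\setminus S$, let $\delta_S(u)=|\{v\in S:\{u,v\}\in E(G)\}|$, and let $G[S]$ be the subgraph induced by $S$. The defensive alliance polynomial of $G$ is $$da(G;x,y)=\sum_{S} x^{|S|}\,y^{f_y(S)},\qquad f_y(S)=\min_{u\in S}\bigl(\delta_S(u)-\delta_{\bar S}(u)+|V(G)|\bigr),$$ where the sum runs over all non-empty $S\subseteq V(G)$ such that $G[S]$ is connected (single-vertex graphs are connected). $[x^k]\,da(G;x,y)$ denotes the coefficient of $x^k$ in $da(G;x,y)$, which is a polynomial in $y$. The quadrilateral book graph $B_{n,2}$ has the $2n+2$ vertices $v_a,v_b,v_{1a},v_{1b},\dots,v_{na},v_{nb}$ and the $3n+1$ edges $\{v_a,v_b\}$ and, for each $1\le i\le n$, $\{v_a,v_{ia}\}$, $\{v_{ia},v_{ib}\}$, $\{v_{ib},v_b\}$ (that is, $n$ four-cycles sharing the common edge $\{v_a,v_b\}$). -}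

module Defs where

open import Data.Bool.Base using (if_then_else_)
open import Data.Fin.Base using (Fin; zero; suc)
import Data.Fin.Properties as Fin
open import Data.Fin.Subset using (Subset; inside; outside; _∈_; _∩_; ∁; ∣_∣; Nonempty)
open import Data.Fin.Subset.Properties using (_∈?_; nonempty?)
open import Data.List.Base using (List; []; _∷_; _++_; map; filter; allFin)
open import Data.List.Extrema.Nat using (min)
open import Data.Nat.Base using (ℕ; zero; suc; _+_; _∸_)
open import Data.Nat.ListAction using (sum)
import Data.Nat.Properties as ℕ
open import Data.Product.Base using (Σ; Σ-syntax; ∃; ∃-syntax; _×_; _,_; proj₁; proj₂)
open import Data.Sum.Base using (_⊎_; inj₁; inj₂)
import Data.Vec.Base as Vec
open import Data.Vec.Properties.WithK using ([]=-irrelevant)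
open import Function.Bundles using (_↔_; _⇔_; Inverse)
open import Level using (0ℓ)
open import Relation.Binary.Construct.Closure.ReflexiveTransitive
  using (Star; ε; _◅_; _◅◅_; gmap)
open import Relation.Binary.Construct.Closure.Symmetric
  using (SymClosure; fwd; bwd; symmetric)
open import Relation.Binary.Core using (Rel)
open import Relation.Binary.Definitions using (Decidable; Symmetric)
open import Relation.Binary.PropositionalEquality using (refl; _≗_)
open import Relation.Nullary using (¬_; Dec; yes; no; does)
open import Relation.Nullary.Decidable using (map′; _×-dec_; _⊎-dec_; _→-dec_)

------------------------------------------------------------------------
-- Simple graphs

record SimpleGraph (V : Set) : Set₁ where
  field
    Adj    : Rel V 0ℓ
    _~?_   : Decidable Adj
    sym    : Symmetric Adj
    irrefl : ∀ {u} → ¬ Adj u u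

open SimpleGraph

_≅_ : ∀ {V W} → SimpleGraph V → SimpleGraph W → Set
_≅_ {V} {W} G H =
  Σ[ φ ∈ V ↔ W ] (∀ u v → Adj G u v ⇔ Adj H (Inverse.to φ u) (Inverse.to φ v))

Connected : ∀ {V} → SimpleGraph V → Set
Connected {V} G = (u v : V) → Star (Adj G) u v

induced : ∀ {V} → SimpleGraph V → (P : V → Set) → SimpleGraph (Σ V P)
induced G P = record
  { Adj    = λ u v → Adj G (proj₁ u) (proj₁ v)
  ; _~?_   = λ u v → _~?_ G (proj₁ u) (proj₁ v)
  ; sym    = sym G
  ; irrefl = irrefl G
  }

_[_] : ∀ {N} → SimpleGraph (Fin N) → (S : Subset N) → SimpleGraph (∃ (_∈ S))
G [ S ] = induced G (_∈ S)

------------------------------------------------------------------------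
-- Decidability of connectedness

-- Reachability for a decidable relation on Fin n is decidable, by
-- eliminating the vertex zero: `bypass R` also has an edge for every
-- R-path of length two through zero.

private
  bypass : ∀ {n} → Rel (Fin (suc n)) 0ℓ → Rel (Fin n) 0ℓ
  bypass R i j = R (suc i) (suc j) ⊎ (R (suc i) zero × R zero (suc j))

  module _ {n} {R : Rel (Fin (suc n)) 0ℓ} where

    unbypass : ∀ {i j} → Star (bypass R) i j → Star R (suc i) (suc j)
    unbypass ε                    = ε
    unbypass (inj₁ r ◅ p)         = r ◅ unbypass p
    unbypass (inj₂ (r , r′) ◅ p)  = r ◅ r′ ◅ unbypass p

    FromZero : Fin n → Set
    FromZero j = ∃[ k ] (R zero (suc k) × Star (bypass R) k j)

    ToZero : Fin n → Set
    ToZero i = ∃[ k ] (Star (bypass R) i k × R (suc k) zero)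

    fromZero : ∀ {j} → Star R zero (suc j) → FromZero j
    fromSuc  : ∀ {i j} → Star R (suc i) (suc j) → Star (bypass R) i j

    fromZero (_◅_ {j = zero}  r p) = fromZero p
    fromZero (_◅_ {j = suc k} r p) = k , r , fromSuc p

    fromSuc ε = ε
    fromSuc (_◅_ {j = suc k} r p) = inj₁ r ◅ fromSuc p
    fromSuc (_◅_ {j = zero}  r p) with fromZero p
    ... | k , r′ , q = inj₂ (r , r′) ◅ q

    toZero : ∀ {i} → Star R (suc i) zero → ToZero i
    toZero (_◅_ {j = zero}  r p) = _ , ε , r
    toZero (_◅_ {j = suc k} r p) with toZero p
    ... | l , q , r′ = l , inj₁ r ◅ q , r′

  star? : ∀ {n} {R : Rel (Fin n) 0ℓ} → Decidable R → Decidable (Star R)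
  star? {suc n} {R} R? = dec
    where
    bypass? : Decidable (bypass R)
    bypass? i j = R? (suc i) (suc j) ⊎-dec (R? (suc i) zero ×-dec R? zero (suc j))

    dec : Decidable (Star R)
    dec zero    zero    = yes ε
    dec zero    (suc j) =
      map′ (λ (k , r , p) → r ◅ unbypass p) fromZero
           (Fin.any? λ k → R? zero (suc k) ×-dec star? bypass? k j)
    dec (suc i) zero    =
      map′ (λ (k , p , r) → unbypass p ◅◅ (r ◅ ε)) toZero
           (Fin.any? λ k → star? bypass? i k ×-dec R? (suc k) zero)
    dec (suc i) (suc j) = map′ unbypass fromSuc (star? bypass? i j)

  module _ {N} (G : SimpleGraph (Fin N)) (S : Subset N) where

    Within : Rel (Fin N) 0ℓ
    Within u v = u ∈ S × v ∈ S × Adj G u v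

    within? : Decidable Within
    within? u v = (u ∈? S) ×-dec ((v ∈? S) ×-dec _~?_ G u v)

    lift : ∀ {u v} → Star Within u v → (u∈S : u ∈ S) (v∈S : v ∈ S) →
           Star (Adj (G [ S ])) (u , u∈S) (v , v∈S)
    lift ε u∈S v∈S rewrite []=-irrelevant u∈S v∈S = ε
    lift ((_ , w∈S , u~w) ◅ p) u∈S v∈S = _◅_ {j = _ , w∈S} u~w (lift p w∈S v∈S)

    lower : ∀ {u v} → Star (Adj (G [ S ])) u v → Star Within (proj₁ u) (proj₁ v)
    lower = gmap proj₁ (λ {u} {v} u~v → proj₂ u , proj₂ v , u~v)

    allReachable? : Dec (∀ u → u ∈ S → ∀ v → v ∈ S → Star Within u v)
    allReachable? = Fin.all? λ u → (u ∈? S) →-dec (Fin.all? λ v →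
                      (v ∈? S) →-dec star? within? u v)

connected? : ∀ {N} (G : SimpleGraph (Fin N)) (S : Subset N) → Dec (Connected (G [ S ]))
connected? G S =
  map′ (λ f (u , u∈S) (v , v∈S) → lift G S (f u u∈S v v∈S) u∈S v∈S)
       (λ c u u∈S v v∈S → lower G S (c (u , u∈S) (v , v∈S)))
       (allReachable? G S)

------------------------------------------------------------------------
-- Polynomials over ℕ

-- A polynomial in y is given by its coefficients, and a polynomial in x
-- and y by its coefficients (polynomials in y) at the powers of x.  Only
-- finite sums of monomials are ever formed.

Poly : Set
Poly = ℕ → ℕ

Poly₂ : Set
Poly₂ = ℕ → Poly

infix  4 _≈_
infixl 6 _⊕_
infix  7 _·y^_

_≈_ : Rel Poly 0ℓ
_≈_ = _≗_

_⊕_ : Poly → Poly → Poly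
(p ⊕ q) j = p j + q j

_·y^_ : ℕ → ℕ → Poly
(c ·y^ e) j = if does (e ℕ.≟ j) then c else 0

x^_·_ : ℕ → Poly → Poly₂
(x^ i · p) k j = if does (i ℕ.≟ k) then p j else 0

∑ : List Poly₂ → Poly₂
∑ ps k j = sum (map (λ p → p k j) ps)

[x^_] : ℕ → Poly₂ → Poly
[x^ k ] P = P k

------------------------------------------------------------------------
-- The defensive alliance polynomial

subsets : ∀ n → List (Subset n)
subsets zero    = Vec.[] ∷ []
subsets (suc n) = map (outside Vec.∷_) (subsets n) ++ map (inside Vec.∷_) (subsets n)

-- The value at [] is never used: f below is only summed over non-empty S.
minimum : List ℕ → ℕ
minimum []       = 0
minimum (x ∷ xs) = min x xs

module _ {N} (G : SimpleGraph (Fin N)) where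

  neighbours : Fin N → Subset N
  neighbours u = Vec.tabulate (λ v → does (_~?_ G u v))

  δ : Subset N → Fin N → ℕ
  δ S u = ∣ S ∩ neighbours u ∣

  -- δ (∁ S) u ≤ N, so adding N before subtracting means that ∸ never
  -- truncates.
  f : Subset N → ℕ
  f S = minimum (map (λ u → (δ S u + N) ∸ δ (∁ S) u) (filter (_∈? S) (allFin N)))

  Admissible : Subset N → Set
  Admissible S = Nonempty S × Connected (G [ S ])

  admissible? : (S : Subset N) → Dec (Admissible S)
  admissible? S = nonempty? S ×-dec connected? G S

  da : Poly₂
  da = ∑ (map (λ S → x^ ∣ S ∣ · (1 ·y^ f S)) (filter admissible? (subsets N)))

------------------------------------------------------------------------
-- The quadrilateral book graph

data Side : Set where
  a b : Side

data BookVertex (n : ℕ) : Set where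
  spine : Side → BookVertex n
  page  : Fin n → Side → BookVertex n

data BookEdge {n} : Rel (BookVertex n) 0ℓ where
  ab    : BookEdge (spine a) (spine b)
  a-ia  : ∀ i → BookEdge (spine a) (page i a)
  ia-ib : ∀ i → BookEdge (page i a) (page i b)
  ib-b  : ∀ i → BookEdge (page i b) (spine b)

bookEdge? : ∀ {n} → Decidable (BookEdge {n})
bookEdge? (spine a)  (spine a)  = no λ ()
bookEdge? (spine a)  (spine b)  = yes ab
bookEdge? (spine a)  (page i a) = yes (a-ia i)
bookEdge? (spine a)  (page i b) = no λ ()
bookEdge? (spine b)  _          = no λ ()
bookEdge? (page i a) (spine _)  = no λ ()
bookEdge? (page i a) (page j a) = no λ ()
bookEdge? (page i a) (page j b) = map′ (λ { refl → ia-ib i }) (λ { (ia-ib _) → refl }) (i Fin.≟ j)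
bookEdge? (page i b) (spine a)  = no λ ()
bookEdge? (page i b) (spine b)  = yes (ib-b i)
bookEdge? (page i b) (page _ _) = no λ ()

Book : ∀ n → SimpleGraph (BookVertex n)
Book n = record
  { Adj    = SymClosure BookEdge
  ; _~?_   = λ u v → map′ (λ { (inj₁ e) → fwd e ; (inj₂ e) → bwd e })
                          (λ { (fwd e) → inj₁ e ; (bwd e) → inj₂ e })
                          (bookEdge? u v ⊎-dec bookEdge? v u)
  ; sym    = symmetric BookEdge
  ; irrefl = λ { (fwd ()) ; (bwd ()) }
  }

{-# OPTIONS --safe #-}

-- From the coefficients to the book.  The coefficient of x gives |V(G)| and the
-- degrees: two hubs of degree n + 1, and 2n further vertices of degree 2.  The
-- coefficient of x^(2n+1) says that G has no cut vertex and that, if n ≥ 2,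
-- every vertex has a neighbour of degree 2.  Hence the degrees inside the set D
-- of the 2n non-hubs sum to at least 2n; as the total degree of D is 4n, the
-- hubs are then adjacent and D induces a perfect matching.  The two ends of a
-- matched pair hang on different hubs, since otherwise their common hub would be
-- a cut vertex.  This is the book.  (If n = 1, the graph is 2-regular on four
-- vertices; any two adjacent vertices serve as hubs.)
--
-- From the book to the coefficients.  Each coefficient is a sum over vertices or
-- ordered pairs of vertices, which the isomorphism turns into a sum over the
-- vertices of the book.

module Submission where

open import Defs
open import Data.Bool.Base using (Bool; true; false; if_then_else_; _∧_; _∨_; not)
open import Data.Bool.Properties using (∨-identityʳ)
open import Data.Fin.Base
  using (Fin; zero; suc; toℕ; fromℕ<; punchIn; punchOut; splitAt; join; _↑ˡ_; _↑ʳ_)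
open import Data.Fin.Permutation using (↔⇒≡)
import Data.Fin.Properties as Fin
open import Data.Fin.Subset using (Subset; inside; outside; _∈_; _∉_; _∩_; _∪_; ∁; ∣_∣; ⊥; ⊤; ⁅_⁆)
open import Data.Fin.Subset.Properties
open import Data.List.Base as List using (List; []; _∷_; _++_; filter; allFin)
open import Data.List.Extrema.Nat using (min≤⊤; min≤xs; argmin-sel)
import Data.List.Membership.Propositional as List
import Data.List.Membership.Propositional.Properties as List
import Data.List.Properties as List
import Data.List.Relation.Unary.All as All
open import Data.List.Relation.Unary.Any using (here; there)
open import Data.Nat.Base
  using (ℕ; zero; suc; _+_; _*_; _∸_; _≤_; _<_; _⊔_; z≤n; s≤s; NonZero; >-nonZero⁻¹)
import Data.Nat.ListAction as ListSum
import Data.Nat.ListAction.Properties as ListSum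
open import Data.Nat.Properties
open import Data.Nat.Tactic.RingSolver using (solve-∀)
open import Data.Product.Base using (Σ-syntax; ∃-syntax; _×_; _,_; proj₁; proj₂)
open import Data.Sum.Base as Sum using (_⊎_; inj₁; inj₂)
import Data.Vec.Base as Vec
import Data.Vec.Properties as Vec
open import Data.Vec.Properties.WithK using ([]=-irrelevant)
open import Function.Base using (_∘_; id; const)
open import Function.Bundles using (_↔_; _⇔_; Inverse; Equivalence; mk⇔; mk↔ₛ′)
open import Function.Construct.Composition using (_↔-∘_)
open import Function.Construct.Symmetry using (↔-sym)
open import Level using (0ℓ)
open import Relation.Binary.Construct.Closure.ReflexiveTransitive
  using (Star; ε; _◅_; _◅◅_; reverse)
open import Relation.Binary.Construct.Closure.Symmetric using (fwd; bwd)
open import Relation.Binary.PropositionalEquality hiding ([_])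
open import Relation.Nullary using (¬_; Dec; yes; no; does; contradiction)
open import Relation.Nullary.Decidable using (dec-true; dec-false; does-⇔)
open import Relation.Unary using (Pred; Decidable)

open import Algebra.Properties.Semiring.Sum +-*-semiring
  using (sum; sum-cong-≗; sum-remove; sum-permute; ∑-distrib-+; ∑-comm)

open SimpleGraph renaming (sym to ~-sym)

-- Finite sums of natural numbers.

𝟙 : Bool → ℕ
𝟙 true  = 1
𝟙 false = 0

sum-const : ∀ n c → sum {n} (const c) ≡ n * c
sum-const zero    c = refl
sum-const (suc n) c = cong (c +_) (sum-const n c)

sum-zero : ∀ {n} {g : Fin n → ℕ} → (∀ i → g i ≡ 0) → sum g ≡ 0
sum-zero {n} z = trans (sum-cong-≗ z) (trans (sum-const n 0) (*-zeroʳ n))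

sum-mono-≤ : ∀ {n} {g h : Fin n → ℕ} → (∀ i → g i ≤ h i) → sum g ≤ sum h
sum-mono-≤ {zero}  le = z≤n
sum-mono-≤ {suc n} le = +-mono-≤ (le zero) (sum-mono-≤ (le ∘ suc))

-- A termwise bound that is reached in total leaves slack in no term. This turns a count into a
-- statement about every vertex.
sum-≤-≡ : ∀ {n} {g h : Fin n → ℕ} → (∀ i → g i ≤ h i) → sum h ≤ sum g → ∀ i → g i ≡ h i
sum-≤-≡ {suc n} {g} {h} le ge zero = ≤-antisym (le zero)
  (+-cancelʳ-≤ (sum (h ∘ suc)) _ _ (≤-trans ge (+-monoʳ-≤ (g zero) (sum-mono-≤ (le ∘ suc)))))
sum-≤-≡ {suc n} {g} {h} le ge (suc i) = sum-≤-≡ (le ∘ suc)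
  (+-cancelˡ-≤ (h zero) _ _ (≤-trans ge (+-monoˡ-≤ _ (le zero)))) i

sum-remove₂ : ∀ {n} (u : Fin (suc (suc n))) (v : Fin (suc n)) (g : Fin (suc (suc n)) → ℕ) →
              sum g ≡ g u + (g (punchIn u v) +
                             sum (λ i → g (punchIn u (punchIn v i))))
sum-remove₂ u v g = trans (sum-remove g) (cong (g u +_) (sum-remove (g ∘ punchIn u)))

sum-select : ∀ {n} (i : Fin n) (g : Fin n → ℕ) →
             sum (λ j → 𝟙 (does (i Fin.≟ j)) * g j) ≡ g i
sum-select {suc n} zero g =
  trans (cong₂ _+_ (+-identityʳ (g zero)) (sum-zero {n} λ _ → refl)) (+-identityʳ (g zero))
sum-select {suc n} (suc i) g = sum-select i (g ∘ suc)

sum-filter : ∀ {A : Set} {P : Pred A 0ℓ} (P? : Decidable P) (g : A → ℕ) xs →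
             ListSum.sum (List.map g (filter P? xs)) ≡
             ListSum.sum (List.map (λ x → 𝟙 (does (P? x)) * g x) xs)
sum-filter P? g []       = refl
sum-filter P? g (x ∷ xs) with does (P? x)
... | false = sum-filter P? g xs
... | true  = cong₂ _+_ (sym (+-identityʳ (g x))) (sum-filter P? g xs)

-- Sums over the subsets of a fixed size.

layer : ∀ n → ℕ → (Subset n → ℕ) → ℕ
layer n k w = ListSum.sum (List.map (λ S → if does (∣ S ∣ ≟ k) then w S else 0) (subsets n))

sum-map-zero : ∀ {A : Set} {g : A → ℕ} xs → (∀ x → g x ≡ 0) → ListSum.sum (List.map g xs) ≡ 0
sum-map-zero []       z = refl
sum-map-zero (x ∷ xs) z = cong₂ _+_ (z x) (sum-map-zero xs z)

sum-subsets : ∀ n (g : Subset (suc n) → ℕ) →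
              ListSum.sum (List.map g (subsets (suc n))) ≡
              ListSum.sum (List.map (g ∘ (outside Vec.∷_)) (subsets n)) +
              ListSum.sum (List.map (g ∘ (inside Vec.∷_)) (subsets n))
sum-subsets n g = begin
  ListSum.sum (List.map g (os ++ is))
    ≡⟨ cong ListSum.sum (List.map-++ g os is) ⟩
  ListSum.sum (List.map g os ++ List.map g is)
    ≡⟨ ListSum.sum-++ (List.map g os) _ ⟩
  ListSum.sum (List.map g os) + ListSum.sum (List.map g is)
    ≡⟨ cong₂ (λ xs ys → ListSum.sum xs + ListSum.sum ys) (List.map-∘ (subsets n)) (List.map-∘ (subsets n)) ⟨
  _ ∎
  where
  open ≡-Reasoning
  os is : List (Subset (suc n))
  os = List.map (outside Vec.∷_) (subsets n)
  is = List.map (inside Vec.∷_) (subsets n)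

-- Splits on whether vertex `zero` lies in the set. Comparing two successors reduces to comparing
-- their predecessors, so after `sum-subsets` both halves already are layers.
layer-suc : ∀ n k w → layer (suc n) (suc k) w ≡
            layer n (suc k) (w ∘ (outside Vec.∷_)) + layer n k (w ∘ (inside Vec.∷_))
layer-suc n k w = sum-subsets n _

layer-0 : ∀ n w → layer n 0 w ≡ w ⊥
layer-0 zero    w = +-identityʳ (w ⊥)
layer-0 (suc n) w = begin
  layer (suc n) 0 w                     ≡⟨ sum-subsets n _ ⟩
  layer n 0 (w ∘ (outside Vec.∷_)) + _
    ≡⟨ cong₂ _+_ (layer-0 n _) (sum-map-zero (subsets n) λ _ → refl) ⟩
  w ⊥ + 0                               ≡⟨ +-identityʳ (w ⊥) ⟩
  w ⊥                                   ∎
  where open ≡-Reasoning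

layer-1 : ∀ n w → layer n 1 w ≡ sum (λ u → w ⁅ u ⁆)
layer-1 zero    w = refl
layer-1 (suc n) w = begin
  layer (suc n) 1 w                            ≡⟨ layer-suc n 0 w ⟩
  layer n 1 (w ∘ (outside Vec.∷_)) + layer n 0 (w ∘ (inside Vec.∷_))
                                               ≡⟨ cong₂ _+_ (layer-1 n _) (layer-0 n _) ⟩
  sum (λ u → w ⁅ suc u ⁆) + w ⁅ zero ⁆         ≡⟨ +-comm _ (w ⁅ zero ⁆) ⟩
  sum (λ u → w ⁅ u ⁆)                          ∎
  where open ≡-Reasoning

-- Sums over ordered pairs need no choice of order on the vertices, and so can be carried along an
-- isomorphism. The first factor removes the diagonal, where the union is a single vertex.
pairs : ∀ {n} → (Subset n → ℕ) → Fin n → Fin n → ℕ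
pairs w u v = 𝟙 (not (does (u Fin.≟ v))) * w (⁅ u ⁆ ∪ ⁅ v ⁆)

-- Doubled because a two-element set arises from two ordered pairs. The sets containing `zero` give
-- one row and one column of the square, the induction hypothesis gives the rest.
layer-2 : ∀ n w → layer n 2 w + layer n 2 w ≡ sum (λ u → sum (λ v → pairs w u v))
layer-2 zero    w = refl
layer-2 (suc n) w = begin
  layer (suc n) 2 w + layer (suc n) 2 w  ≡⟨ cong (λ x → x + x) (layer-suc n 1 w) ⟩
  (l₂ + l₁) + (l₂ + l₁)                  ≡⟨ shuffle l₂ l₁ ⟩
  l₁ + (l₁ + (l₂ + l₂))                  ≡⟨ cong₂ (λ x y → x + (y + (l₂ + l₂))) row column ⟩
  sum (λ v → pairs w zero (suc v)) +
    (sum (λ u → pairs w (suc u) zero) + (l₂ + l₂))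
    ≡⟨ cong (λ x → sum (λ v → pairs w zero (suc v)) + (sum (λ u → pairs w (suc u) zero) + x))
         (layer-2 n _) ⟩
  sum (λ v → pairs w zero (suc v)) +
    (sum (λ u → pairs w (suc u) zero) + sum (λ u → sum (λ v → pairs w (suc u) (suc v))))
    ≡⟨ cong (sum (λ v → pairs w zero (suc v)) +_) (∑-distrib-+ (λ u → pairs w (suc u) zero) _) ⟨
  sum (λ u → sum (λ v → pairs w u v))    ∎
  where
  open ≡-Reasoning
  l₁ l₂ : ℕ
  l₁ = layer n 1 (w ∘ (inside Vec.∷_))
  l₂ = layer n 2 (w ∘ (outside Vec.∷_))
  shuffle : ∀ x y → (x + y) + (x + y) ≡ y + (y + (x + x))
  shuffle = solve-∀
  row : l₁ ≡ sum (λ v → pairs w zero (suc v))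
  row = trans (layer-1 n _) (sum-cong-≗ λ v →
    trans (cong (λ S → w (inside Vec.∷ S)) (sym (∪-identityˡ ⁅ v ⁆))) (sym (*-identityˡ _)))
  column : l₁ ≡ sum (λ u → pairs w (suc u) zero)
  column = trans (layer-1 n _) (sum-cong-≗ λ v →
    trans (cong (λ S → w (inside Vec.∷ S)) (sym (∪-identityʳ ⁅ v ⁆))) (sym (*-identityˡ _)))

layer-> : ∀ {n k} w → n < k → layer n k w ≡ 0
layer-> {n} {k} w n<k = sum-map-zero (subsets n) λ S →
  cong (if_then w S else 0) (dec-false (∣ S ∣ ≟ k) (<⇒≢ (≤-<-trans (∣p∣≤n S) n<k)))

layer-full : ∀ n w → layer n n w ≡ w ⊤
layer-full zero    w = +-identityʳ (w ⊤)
layer-full (suc n) w =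
  trans (layer-suc n n w) (cong₂ _+_ (layer-> {n} (w ∘ (outside Vec.∷_)) (n<1+n n)) (layer-full n _))

∁⊥≡⊤ : ∀ {n} → ∁ ⊥ ≡ ⊤ {n}
∁⊥≡⊤ {n} = Vec.map-replicate not outside n

-- A set of size `n` misses one of the `suc n` vertices: either `zero`, with the full set left on
-- the others, or a later vertex, by induction.
layer-coatom : ∀ n w → layer (suc n) n w ≡ sum (λ v → w (∁ ⁅ v ⁆))
layer-coatom zero    w = trans (layer-0 1 w) (sym (+-identityʳ _))
layer-coatom (suc n) w =
  trans (layer-suc (suc n) n w) (cong₂ _+_
    (trans (layer-full (suc n) _) (cong (w ∘ (outside Vec.∷_)) (sym ∁⊥≡⊤)))
    (layer-coatom n _))

-- Monomials in y, enumerations and minima.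

·y^-scale : ∀ c e j → (c ·y^ e) j ≡ c * (1 ·y^ e) j
·y^-scale c e j with does (e ≟ j)
... | true  = sym (*-identityʳ c)
... | false = sym (*-zeroʳ c)

·y^-≡ : ∀ c e → (c ·y^ e) e ≡ c
·y^-≡ c e = cong (if_then c else 0) (dec-true (e ≟ e) refl)

·y^-≢ : ∀ c {e j} → e ≢ j → (c ·y^ e) j ≡ 0
·y^-≢ c {e} {j} e≢j = cong (if_then c else 0) (dec-false (e ≟ j) e≢j)

-- Evaluation at y = 1, cut off at a degree `m` above the exponent.
sum-·y^ : ∀ {m} c e → e < m → sum {m} (λ j → (c ·y^ e) (toℕ j)) ≡ c
sum-·y^ {m} c e e<m = begin
  sum {m} (λ j → (c ·y^ e) (toℕ j))                  ≡⟨ sum-cong-≗ {m} step ⟩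
  sum {m} (λ j → 𝟙 (does (fromℕ< e<m Fin.≟ j)) * c)  ≡⟨ sum-select (fromℕ< e<m) (const c) ⟩
  c                                              ∎
  where
  open ≡-Reasoning
  step : ∀ j → (c ·y^ e) (toℕ j) ≡ 𝟙 (does (fromℕ< e<m Fin.≟ j)) * c
  step j with fromℕ< e<m Fin.≟ j
  ... | yes refl = trans (cong (c ·y^ e) (Fin.toℕ-fromℕ< e<m)) (trans (·y^-≡ c e) (sym (*-identityˡ c)))
  ... | no  ne   = ·y^-≢ c λ e≡j → ne (Fin.toℕ-injective (trans (Fin.toℕ-fromℕ< e<m) e≡j))

-- Converts a count into data: a list without repetition of the places where `p` holds. It later
-- yields the two hubs, the mate of a vertex and the neighbours of a hub.
enumerate : ∀ {m k} (p : Fin m → Bool) → sum (𝟙 ∘ p) ≡ k →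
            Σ[ e ∈ (Fin k → Fin m) ]
              (∀ {i j} → e i ≡ e j → i ≡ j) ×
              (∀ i → p (e i) ≡ true) ×
              (∀ u → p u ≡ true → ∃[ i ] e i ≡ u)
enumerate {zero}  p refl = (λ ()) , (λ { {()} }) , (λ ()) , (λ ())
enumerate {suc m} p eq with p zero in p0
... | false with enumerate (p ∘ suc) eq
...   | e , inj , sound , complete = suc ∘ e , inj ∘ Fin.suc-injective , sound , complete′
  where
  complete′ : ∀ u → p u ≡ true → ∃[ i ] suc (e i) ≡ u
  complete′ zero    pu with () ← trans (sym p0) pu
  complete′ (suc u) pu with complete u pu
  ... | i , refl = i , refl
enumerate {suc m} {suc k} p eq | true with enumerate (p ∘ suc) (suc-injective eq)
...   | e , inj , sound , complete = e′ , inj′ , sound′ , complete′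
  where
  e′ : Fin (suc k) → Fin (suc m)
  e′ zero    = zero
  e′ (suc i) = suc (e i)
  inj′ : ∀ {i j} → e′ i ≡ e′ j → i ≡ j
  inj′ {zero}  {zero}  _  = refl
  inj′ {suc i} {suc j} q  = cong suc (inj (Fin.suc-injective q))
  sound′ : ∀ i → p (e′ i) ≡ true
  sound′ zero    = p0
  sound′ (suc i) = sound i
  complete′ : ∀ u → p u ≡ true → ∃[ i ] e′ i ≡ u
  complete′ zero    pu = zero , refl
  complete′ (suc u) pu with complete u pu
  ... | i , refl = suc i , refl

minimum-≤ : ∀ {x xs} → x List.∈ xs → minimum xs ≤ x
minimum-≤ {xs = y ∷ ys} (here refl) = min≤⊤ y ys
minimum-≤ {xs = y ∷ ys} (there x∈)  = All.lookup (min≤xs y ys) x∈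

minimum-∈ : ∀ {x xs} → x List.∈ xs → minimum xs List.∈ xs
minimum-∈ {xs = y ∷ ys} _ with argmin-sel id y ys
... | inj₁ eq = here eq
... | inj₂ m∈ = there m∈

∣∣-sum : ∀ {n} (S : Subset n) → ∣ S ∣ ≡ sum (λ v → 𝟙 (Vec.lookup S v))
∣∣-sum Vec.[]            = refl
∣∣-sum (true Vec.∷ S)  = cong suc (∣∣-sum S)
∣∣-sum (false Vec.∷ S) = ∣∣-sum S

𝟙-∧ : ∀ p q → 𝟙 (p ∧ q) ≡ 𝟙 p * 𝟙 q
𝟙-∧ true  q = sym (+-identityʳ (𝟙 q))
𝟙-∧ false q = refl

𝟙-not : ∀ p → 𝟙 p + 𝟙 (not p) ≡ 1
𝟙-not true  = refl
𝟙-not false = refl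

𝟙-≤1 : ∀ p → 𝟙 p ≤ 1
𝟙-≤1 true  = ≤-refl
𝟙-≤1 false = z≤n

𝟙-does⁻ : ∀ {P : Set} (d : Dec P) → 𝟙 (does d) ≡ 1 → P
𝟙-does⁻ (yes p) _ = p

·y^-1⁻ : ∀ {e j} → (1 ·y^ e) j ≡ 1 → e ≡ j
·y^-1⁻ {e} {j} eq with e ≟ j
... | yes e≡j = e≡j
... | no  e≢j with () ← trans (sym (·y^-≢ 1 e≢j)) eq

·y^-≤ : ∀ c e j → (c ·y^ e) j ≤ c
·y^-≤ c e j with does (e ≟ j)
... | true  = ≤-refl
... | false = z≤n

lookup-∈ : ∀ {n v} {S : Subset n} → v ∈ S → Vec.lookup S v ≡ true
lookup-∈ = Vec.[]=⇒lookup

lookup-∉ : ∀ {n v} {S : Subset n} → v ∉ S → Vec.lookup S v ≡ false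
lookup-∉ {v = v} {S} v∉S with Vec.lookup S v in eq
... | true  = contradiction (Vec.lookup⇒[]= v S eq) v∉S
... | false = refl

lookup-⁅⁆ : ∀ {n} (u v : Fin n) → Vec.lookup ⁅ u ⁆ v ≡ does (u Fin.≟ v)
lookup-⁅⁆ u v with u Fin.≟ v
... | yes refl = lookup-∈ (x∈⁅x⁆ u)
... | no  u≢v  = lookup-∉ (x≢y⇒x∉⁅y⁆ (u≢v ∘ sym))

-- Degrees, scores and connectivity.

adjacency : ∀ {V} → SimpleGraph V → V → V → ℕ
adjacency G u v = 𝟙 (does (_~?_ G u v))

module _ {V : Set} (G : SimpleGraph V) where

  adjacency-1 : ∀ {u v} → Adj G u v → adjacency G u v ≡ 1
  adjacency-1 {u} {v} u~v = cong 𝟙 (dec-true (_~?_ G u v) u~v)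

  adjacency-0 : ∀ {u v} → ¬ Adj G u v → adjacency G u v ≡ 0
  adjacency-0 {u} {v} u≁v = cong 𝟙 (dec-false (_~?_ G u v) u≁v)

  adjacency-1⁻ : ∀ {u v} → adjacency G u v ≡ 1 → Adj G u v
  adjacency-1⁻ {u} {v} eq with _~?_ G u v
  ... | yes u~v = u~v

  adjacency-sym : ∀ u v → adjacency G u v ≡ adjacency G v u
  adjacency-sym u v = cong 𝟙 (does-⇔ (mk⇔ (~-sym G) (~-sym G)) (_~?_ G u v) (_~?_ G v u))

module _ {N : ℕ} (G : SimpleGraph (Fin N)) where

  deg : Fin N → ℕ
  deg u = sum (adjacency G u)

  δ-sum : ∀ S u → δ G S u ≡ sum (λ v → 𝟙 (Vec.lookup S v) * adjacency G u v)
  δ-sum S u = trans (∣∣-sum (S ∩ neighbours G u)) (sum-cong-≗ {N} λ v → trans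
    (cong 𝟙 (trans (Vec.lookup-zipWith _∧_ v S _)
                   (cong (Vec.lookup S v ∧_) (Vec.lookup∘tabulate _ v))))
    (𝟙-∧ (Vec.lookup S v) _))

  δ+δ∁ : ∀ S u → δ G S u + δ G (∁ S) u ≡ deg u
  δ+δ∁ S u = begin
    δ G S u + δ G (∁ S) u  ≡⟨ cong₂ _+_ (δ-sum S u) (δ-sum (∁ S) u) ⟩
    _                      ≡⟨ ∑-distrib-+ {N} _ _ ⟨
    sum {N} _              ≡⟨ sum-cong-≗ {N} step ⟩
    deg u                  ∎
    where
    open ≡-Reasoning
    step : ∀ v → 𝟙 (Vec.lookup S v) * adjacency G u v + 𝟙 (Vec.lookup (∁ S) v) * adjacency G u v
                 ≡ adjacency G u v
    step v = begin
      s * χ + 𝟙 (Vec.lookup (∁ S) v) * χ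
        ≡⟨ cong (λ b → s * χ + 𝟙 b * χ) (Vec.lookup-map v not S) ⟩
      s * χ + 𝟙 (not (Vec.lookup S v)) * χ  ≡⟨ *-distribʳ-+ χ s _ ⟨
      (s + 𝟙 (not (Vec.lookup S v))) * χ    ≡⟨ cong (_* χ) (𝟙-not (Vec.lookup S v)) ⟩
      1 * χ                               ≡⟨ *-identityˡ χ ⟩
      χ                                   ∎
      where
      s χ : ℕ
      s = 𝟙 (Vec.lookup S v)
      χ = adjacency G u v

  -- Both are what `δ G (∁ S) u` lacks to the degree of `u`.
  δ-∁∁ : ∀ S u → δ G (∁ (∁ S)) u ≡ δ G S u
  δ-∁∁ S u = +-cancelˡ-≡ (δ G (∁ S) u) _ _
    (trans (δ+δ∁ (∁ S) u) (trans (sym (δ+δ∁ S u)) (+-comm (δ G S u) _)))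

  δ-⁅⁆ : ∀ u v → δ G ⁅ v ⁆ u ≡ adjacency G u v
  δ-⁅⁆ u v = begin
    δ G ⁅ v ⁆ u                                           ≡⟨ δ-sum ⁅ v ⁆ u ⟩
    sum (λ w → 𝟙 (Vec.lookup ⁅ v ⁆ w) * adjacency G u w)
      ≡⟨ sum-cong-≗ {N} (λ w → cong (λ b → 𝟙 b * adjacency G u w) (lookup-⁅⁆ v w)) ⟩
    _                                                     ≡⟨ sum-select v (adjacency G u) ⟩
    adjacency G u v                                       ∎
    where open ≡-Reasoning

  δ-⊤ : ∀ u → δ G ⊤ u ≡ deg u
  δ-⊤ u = trans (δ-sum ⊤ u) (sum-cong-≗ {N} λ v →
    trans (cong (λ b → 𝟙 b * adjacency G u v) (lookup-∈ {v = v} ∈⊤)) (*-identityˡ _))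

  δ-∁⊤ : ∀ u → δ G (∁ ⊤) u ≡ 0
  δ-∁⊤ u = +-cancelˡ-≡ (δ G ⊤ u) _ _ (trans (δ+δ∁ ⊤ u) (trans (sym (δ-⊤ u)) (sym (+-identityʳ _))))

  δ-pair : ∀ u v → δ G (⁅ u ⁆ ∪ ⁅ v ⁆) u ≡ adjacency G u v
  δ-pair u v = trans (trans (δ-sum (⁅ u ⁆ ∪ ⁅ v ⁆) u) (trans (sum-cong-≗ {N} step) (sym (δ-sum ⁅ v ⁆ u)))) (δ-⁅⁆ u v)
    where
    step : ∀ w → 𝟙 (Vec.lookup (⁅ u ⁆ ∪ ⁅ v ⁆) w) * adjacency G u w ≡
                 𝟙 (Vec.lookup ⁅ v ⁆ w) * adjacency G u w
    step w with u Fin.≟ w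
    ... | yes refl rewrite adjacency-0 G (irrefl G {u}) =
      trans (*-zeroʳ (𝟙 (Vec.lookup (⁅ u ⁆ ∪ ⁅ v ⁆) u))) (sym (*-zeroʳ (𝟙 (Vec.lookup ⁅ v ⁆ u))))
    ... | no  u≢w  = cong (λ b → 𝟙 b * adjacency G u w)
      (trans (Vec.lookup-zipWith _ w ⁅ u ⁆ ⁅ v ⁆)
             (cong (_∨ Vec.lookup ⁅ v ⁆ w) (lookup-∉ (x≢y⇒x∉⁅y⁆ (u≢w ∘ sym)))))

  score : Subset N → Fin N → ℕ
  score S u = (δ G S u + N) ∸ δ G (∁ S) u

  score-∈ : ∀ {S u} → u ∈ S → score S u List.∈ List.map (score S) (filter (_∈? S) (allFin N))
  score-∈ {S} {u} u∈S = List.∈-map⁺ (score S) (List.∈-filter⁺ (_∈? S) (List.∈-allFin u) u∈S)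

  f-≤ : ∀ {S u} → u ∈ S → f G S ≤ score S u
  f-≤ u∈S = minimum-≤ (score-∈ u∈S)

  f-attained : ∀ {S u} → u ∈ S → ∃[ w ] w ∈ S × f G S ≡ score S w
  f-attained {S} u∈S with List.∈-map⁻ (score S) (minimum-∈ (score-∈ u∈S))
  ... | w , w∈ , eq = w , proj₂ (List.∈-filter⁻ (_∈? S) {xs = allFin N} w∈) , eq

  f-≡ : ∀ {S u k} → u ∈ S → score S u ≡ k → (∀ {w} → w ∈ S → k ≤ score S w) → f G S ≡ k
  f-≡ {S} u∈S refl lower with f-attained u∈S
  ... | w , w∈S , eq = ≤-antisym (f-≤ u∈S) (≤-trans (lower w∈S) (≤-reflexive (sym eq)))

  -- Admissibility enters as a factor 0 or 1 instead of a filter, so that a coefficient of `da G`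
  -- becomes a `layer` over all sets of one size.
  weight : ℕ → Subset N → ℕ
  weight j S = 𝟙 (does (admissible? G S)) * (1 ·y^ f G S) j

  weight-yes : ∀ {j S} → Admissible G S → weight j S ≡ (1 ·y^ f G S) j
  weight-yes {j} {S} p = trans (cong (λ b → 𝟙 b * (1 ·y^ f G S) j) (dec-true (admissible? G S) p)) (*-identityˡ _)

  weight-no : ∀ {j S} → ¬ Admissible G S → weight j S ≡ 0
  weight-no {j} {S} p = cong (λ b → 𝟙 b * (1 ·y^ f G S) j) (dec-false (admissible? G S) p)

  weight-1⁻ : ∀ {j S} → weight j S ≡ 1 → Admissible G S × f G S ≡ j
  weight-1⁻ {j} {S} eq =
    𝟙-does⁻ (admissible? G S) (m*n≡1⇒m≡1 _ ((1 ·y^ f G S) j) eq) ,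
    ·y^-1⁻ (m*n≡1⇒n≡1 (𝟙 (does (admissible? G S))) _ eq)

  weight-≤1 : ∀ j S → weight j S ≤ 1
  weight-≤1 j S = *-mono-≤ (𝟙-≤1 (does (admissible? G S))) (·y^-≤ 1 (f G S) j)

  coefficient : ∀ k j → [x^ k ] (da G) j ≡ layer N k (weight j)
  coefficient k j = begin
    ListSum.sum (List.map (λ p → p k j) (List.map monomial (filter (admissible? G) (subsets N))))
      ≡⟨ cong ListSum.sum (List.map-∘ (filter (admissible? G) (subsets N))) ⟨
    ListSum.sum (List.map (λ S → monomial S k j) (filter (admissible? G) (subsets N)))
      ≡⟨ sum-filter (admissible? G) (λ S → monomial S k j) (subsets N) ⟩
    ListSum.sum (List.map (λ S → 𝟙 (does (admissible? G S)) * monomial S k j) (subsets N))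
      ≡⟨ cong ListSum.sum (List.map-cong step (subsets N)) ⟩
    layer N k (weight j) ∎
    where
    open ≡-Reasoning
    monomial : Subset N → Poly₂
    monomial S = x^ ∣ S ∣ · (1 ·y^ f G S)
    step : ∀ S → 𝟙 (does (admissible? G S)) * monomial S k j ≡
                 (if does (∣ S ∣ ≟ k) then weight j S else 0)
    step S with does (∣ S ∣ ≟ k)
    ... | true  = refl
    ... | false = *-zeroʳ (𝟙 (does (admissible? G S)))

  -- The membership proofs of both ends are packed with the walk, so that walks are built without
  -- naming them; `root⇒admissible` identifies them afterwards, membership being proof irrelevant.
  Path : (S : Subset N) → Fin N → Fin N → Set
  Path S u v = Σ[ u∈S ∈ u ∈ S ] Σ[ v∈S ∈ v ∈ S ] Star (Adj (G [ S ])) (u , u∈S) (v , v∈S)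

  path-refl : ∀ {S u} → u ∈ S → Path S u u
  path-refl u∈S = u∈S , u∈S , ε

  path-cons : ∀ {S u v w} → u ∈ S → Adj G u v → Path S v w → Path S u w
  path-cons u∈S u~v (v∈S , w∈S , p) = u∈S , w∈S , u~v ◅ p

  -- Adjacency is symmetric, so two vertices with paths to `r` are joined through `r`.
  root⇒admissible : ∀ {S r} → r ∈ S → (∀ {w} → w ∈ S → Path S w r) → Admissible G S
  root⇒admissible {S} {r} r∈S reach = (r , r∈S) , connected
    where
    to-root : ∀ u → Star (Adj (G [ S ])) u (r , r∈S)
    to-root (u , u∈S) with reach u∈S
    ... | u∈S′ , r∈S′ , p rewrite []=-irrelevant u∈S u∈S′ | []=-irrelevant r∈S r∈S′ = p
    connected : Connected (G [ S ])
    connected u v = to-root u ◅◅ reverse (~-sym G) (to-root v)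

  -- Disconnection is shown by a predicate that no edge inside `S` leaves: a walk started in `P`
  -- cannot end outside it.
  closed⇒unreachable : ∀ {S} (P : Fin N → Set) →
    (∀ {u v} → P u → v ∈ S → Adj G u v → P v) →
    ∀ {u v} → P (proj₁ u) → Star (Adj (G [ S ])) u v → P (proj₁ v)
  closed⇒unreachable P closed Pu ε = Pu
  closed⇒unreachable P closed Pu (_◅_ {j = v , v∈S} u~v p) =
    closed⇒unreachable P closed (closed Pu v∈S u~v) p

  ⁅⁆-admissible : ∀ u → Admissible G ⁅ u ⁆
  ⁅⁆-admissible u = root⇒admissible (x∈⁅x⁆ u) λ w∈ →
    subst (λ w → Path ⁅ u ⁆ w u) (sym (x∈⁅y⁆⇒x≡y u w∈)) (path-refl (x∈⁅x⁆ u))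

-- The coefficients in terms of degrees.

module _ {N : ℕ} (G : SimpleGraph (Fin N)) where

  -- A single vertex has no neighbour inside and all its neighbours outside, so `f` is
  -- `N ∸ deg G u`: the coefficient of x records the degrees.
  coefficient-1 : ∀ j → [x^ 1 ] (da G) j ≡ sum (λ u → (1 ·y^ (N ∸ deg G u)) j)
  coefficient-1 j = trans (coefficient G 1 j) (trans (layer-1 N (weight G j)) (sum-cong-≗ {N} λ u →
    trans (weight-yes G (⁅⁆-admissible G u)) (cong (λ e → (1 ·y^ e) j) (f-⁅⁆ u))))
    where
    f-⁅⁆ : ∀ u → f G ⁅ u ⁆ ≡ N ∸ deg G u
    f-⁅⁆ u = f-≡ G (x∈⁅x⁆ u) score-⁅⁆ λ w∈ → ≤-reflexive (trans (sym score-⁅⁆)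
      (cong (score G ⁅ u ⁆) (sym (x∈⁅y⁆⇒x≡y u w∈))))
      where
      δ≡0 : δ G ⁅ u ⁆ u ≡ 0
      δ≡0 = trans (δ-⁅⁆ G u u) (adjacency-0 G (irrefl G {u}))
      score-⁅⁆ : score G ⁅ u ⁆ u ≡ N ∸ deg G u
      score-⁅⁆ = cong₂ (λ x y → (x + N) ∸ y) δ≡0
        (trans (cong (_+ δ G (∁ ⁅ u ⁆) u) (sym δ≡0)) (δ+δ∁ G ⁅ u ⁆ u))

  coefficient-full : ∀ {k} → k ≡ N → ∀ j → [x^ k ] (da G) j ≡ weight G j ⊤
  coefficient-full refl j = trans (coefficient G N j) (layer-full N (weight G j))

  score-⊤ : ∀ u → score G ⊤ u ≡ deg G u + N
  score-⊤ u = cong₂ (λ x y → (x + N) ∸ y) (δ-⊤ G u) (δ-∁⊤ G u)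

  δ-coatom : ∀ u v → δ G (∁ ⁅ v ⁆) u + adjacency G u v ≡ deg G u
  δ-coatom u v = trans (cong (δ G (∁ ⁅ v ⁆) u +_) (sym (δ-⁅⁆ G u v)))
    (trans (+-comm (δ G (∁ ⁅ v ⁆) u) _) (δ+δ∁ G ⁅ v ⁆ u))

  score-coatom : ∀ u v → score G (∁ ⁅ v ⁆) u ≡ (δ G (∁ ⁅ v ⁆) u + N) ∸ adjacency G u v
  score-coatom u v = cong ((δ G (∁ ⁅ v ⁆) u + N) ∸_) (trans (δ-∁∁ G ⁅ v ⁆ u) (δ-⁅⁆ G u v))

  pair-path : ∀ {u v} → Adj G u v → Path G (⁅ u ⁆ ∪ ⁅ v ⁆) v u
  pair-path {u} {v} u~v = path-cons G (q⊆p∪q ⁅ u ⁆ ⁅ v ⁆ (x∈⁅x⁆ v)) (~-sym G u~v)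
    (path-refl G (p⊆p∪q ⁅ v ⁆ (x∈⁅x⁆ u)))

  ∈-pair : ∀ {u v w : Fin N} → w ∈ ⁅ u ⁆ ∪ ⁅ v ⁆ → w ≡ u ⊎ w ≡ v
  ∈-pair {u} {v} w∈ with x∈p∪q⁻ ⁅ u ⁆ ⁅ v ⁆ w∈
  ... | inj₁ p = inj₁ (x∈⁅y⁆⇒x≡y u p)
  ... | inj₂ p = inj₂ (x∈⁅y⁆⇒x≡y v p)

  pair-admissible : ∀ {u v} → Adj G u v → Admissible G (⁅ u ⁆ ∪ ⁅ v ⁆)
  pair-admissible {u} {v} u~v = root⇒admissible G u∈ reach
    where
    u∈ : u ∈ ⁅ u ⁆ ∪ ⁅ v ⁆
    u∈ = p⊆p∪q ⁅ v ⁆ (x∈⁅x⁆ u)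
    reach : ∀ {w} → w ∈ ⁅ u ⁆ ∪ ⁅ v ⁆ → Path G (⁅ u ⁆ ∪ ⁅ v ⁆) w u
    reach w∈ with ∈-pair w∈
    ... | inj₁ refl = path-refl G u∈
    ... | inj₂ refl = pair-path u~v

  pair-inadmissible : ∀ {u v} → u ≢ v → ¬ Adj G u v → ¬ Admissible G (⁅ u ⁆ ∪ ⁅ v ⁆)
  pair-inadmissible {u} {v} u≢v u≁v (_ , connected) = u≢v (sym
    (closed⇒unreachable G (_≡ u) closed refl
      (connected (u , p⊆p∪q ⁅ v ⁆ (x∈⁅x⁆ u)) (v , q⊆p∪q ⁅ u ⁆ ⁅ v ⁆ (x∈⁅x⁆ v)))))
    where
    closed : ∀ {x y} → x ≡ u → y ∈ ⁅ u ⁆ ∪ ⁅ v ⁆ → Adj G x y → y ≡ u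
    closed refl y∈ x~y with ∈-pair y∈
    ... | inj₁ y≡u  = y≡u
    ... | inj₂ refl = contradiction x~y u≁v

  -- Of the neighbours of `u`, one is inside the pair and all others are outside. Raising both
  -- arguments of the subtraction by one, which keeps its value, brings in the full degree.
  score-pair : ∀ {u v} → Adj G u v → score G (⁅ u ⁆ ∪ ⁅ v ⁆) u ≡ (2 + N) ∸ deg G u
  score-pair {u} {v} u~v = begin
    (δ G S u + N) ∸ δ G (∁ S) u  ≡⟨ cong (λ x → (x + N) ∸ δ G (∁ S) u) δ≡1 ⟩
    (2 + N) ∸ suc (δ G (∁ S) u)  ≡⟨ cong (λ x → (2 + N) ∸ (x + δ G (∁ S) u)) δ≡1 ⟨
    (2 + N) ∸ (δ G S u + δ G (∁ S) u)  ≡⟨ cong ((2 + N) ∸_) (δ+δ∁ G S u) ⟩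
    (2 + N) ∸ deg G u            ∎
    where
    open ≡-Reasoning
    S : Subset N
    S = ⁅ u ⁆ ∪ ⁅ v ⁆
    δ≡1 : δ G S u ≡ 1
    δ≡1 = trans (δ-pair G u v) (adjacency-1 G u~v)

  -- The score falls as the degree grows, so the end of larger degree attains the minimum.
  f-pair : ∀ {u v} → Adj G u v → deg G v ≤ deg G u → f G (⁅ u ⁆ ∪ ⁅ v ⁆) ≡ (2 + N) ∸ deg G u
  f-pair {u} {v} u~v v≤u = f-≡ G (p⊆p∪q ⁅ v ⁆ (x∈⁅x⁆ u)) (score-pair u~v) lower
    where
    lower : ∀ {w} → w ∈ ⁅ u ⁆ ∪ ⁅ v ⁆ → (2 + N) ∸ deg G u ≤ score G (⁅ u ⁆ ∪ ⁅ v ⁆) w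
    lower w∈ with ∈-pair w∈
    ... | inj₁ refl = ≤-reflexive (sym (score-pair u~v))
    ... | inj₂ refl = ≤-trans (∸-monoʳ-≤ (2 + N) v≤u) (≤-reflexive
      (trans (sym (score-pair (~-sym G u~v))) (cong (λ S → score G S v) (∪-comm ⁅ v ⁆ ⁅ u ⁆))))

  f-edge : ∀ {u v} → Adj G u v → f G (⁅ u ⁆ ∪ ⁅ v ⁆) ≡ (2 + N) ∸ (deg G u ⊔ deg G v)
  f-edge {u} {v} u~v with ≤-total (deg G u) (deg G v)
  ... | inj₁ u≤v = trans (cong (f G) (∪-comm ⁅ u ⁆ ⁅ v ⁆)) (trans (f-pair (~-sym G u~v) u≤v)
                     (cong ((2 + N) ∸_) (sym (m≤n⇒m⊔n≡n u≤v))))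
  ... | inj₂ v≤u = trans (f-pair u~v v≤u) (cong ((2 + N) ∸_) (sym (m≥n⇒m⊔n≡m v≤u)))

  -- A pair is connected exactly when it is an edge. On the diagonal the left side vanishes by its
  -- first factor, the right side because there are no loops.
  pairs-weight : ∀ j u v → pairs (weight G j) u v ≡
                 adjacency G u v * (1 ·y^ ((2 + N) ∸ (deg G u ⊔ deg G v))) j
  pairs-weight j u v with u Fin.≟ v
  ... | yes refl = sym (cong (_* (1 ·y^ ((2 + N) ∸ (deg G u ⊔ deg G u))) j) (adjacency-0 G (irrefl G {u})))
  ... | no  u≢v  = trans (*-identityˡ _) weight-pair
    where
    e : ℕ
    e = (2 + N) ∸ (deg G u ⊔ deg G v)
    weight-pair : weight G j (⁅ u ⁆ ∪ ⁅ v ⁆) ≡ adjacency G u v * (1 ·y^ e) j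
    weight-pair with _~?_ G u v
    ... | yes u~v = trans (weight-yes G (pair-admissible u~v)) (trans
      (cong (λ x → (1 ·y^ x) j) (f-edge u~v)) (sym (*-identityˡ ((1 ·y^ e) j))))
    ... | no  u≁v = weight-no G (pair-inadmissible u≢v u≁v)

  -- Every edge is counted once from each of its ends.
  coefficient-2 : ∀ j → [x^ 2 ] (da G) j + [x^ 2 ] (da G) j ≡
    sum (λ u → sum (λ v → adjacency G u v * (1 ·y^ ((2 + N) ∸ (deg G u ⊔ deg G v))) j))
  coefficient-2 j = trans (cong (λ x → x + x) (coefficient G 2 j)) (trans (layer-2 N (weight G j))
    (sum-cong-≗ {N} λ u → sum-cong-≗ {N} (pairs-weight j u)))

coefficient-coatom : ∀ {k N} (G : SimpleGraph (Fin N)) → suc k ≡ N →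
                     ∀ j → [x^ k ] (da G) j ≡ sum (λ v → weight G j (∁ ⁅ v ⁆))
coefficient-coatom {k} G refl j = trans (coefficient G k j) (layer-coatom k (weight G j))

adjacency-≤1 : ∀ {V} (G : SimpleGraph V) u v → adjacency G u v ≤ 1
adjacency-≤1 G u v = 𝟙-≤1 (does (_~?_ G u v))

deg-≤ : ∀ {N} (G : SimpleGraph (Fin N)) u → deg G u ≤ N
deg-≤ {N} G u = ≤-trans (sum-mono-≤ (adjacency-≤1 G u)) (≤-reflexive (trans (sum-const N 1) (*-identityʳ N)))

term-≤-sum : ∀ {n} (g : Fin n → ℕ) i → g i ≤ sum g
term-≤-sum g zero    = m≤m+n (g zero) _
term-≤-sum g (suc i) = ≤-trans (term-≤-sum (g ∘ suc) i) (m≤n+m _ (g zero))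

-- From two hubs to the book.

record TwoHubs {N} (n : ℕ) (G : SimpleGraph (Fin N)) : Set where
  field
    hub₁ hub₂ : Fin N
    hub₁≢hub₂ : hub₁ ≢ hub₂
    deg-hub₁  : deg G hub₁ ≡ n + 1
    deg-hub₂  : deg G hub₂ ≡ n + 1
    deg-rest  : ∀ {u} → u ≢ hub₁ → u ≢ hub₂ → deg G u ≡ 2
    -- For `n` equal to 1 the hubs have degree 2 like all other vertices, and their adjacency is
    -- required outright. The other alternative gives each non-hub a non-hub neighbour, from which
    -- adjacency of the hubs follows by counting.
    tight     : (n ≡ 1 × Adj G hub₁ hub₂) ⊎
                (∀ {u} → u ≢ hub₁ → u ≢ hub₂ → ∃[ w ] (w ≢ hub₁ × w ≢ hub₂ × Adj G u w))
    biconnected : ∀ v → Connected (G [ ∁ ⁅ v ⁆ ])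

module FromHubs {n : ℕ} {G : SimpleGraph (Fin (2 + 2 * n))} (H : TwoHubs n G) where
  open TwoHubs H renaming (hub₁ to α; hub₂ to β; hub₁≢hub₂ to α≢β)

  private
    β′ : Fin (suc (2 * n))
    β′ = punchOut α≢β

    β′≡β : punchIn α β′ ≡ β
    β′≡β = Fin.punchIn-punchOut α≢β

  -- The set D of the non-hubs, listed by removing `α` and then `β` from the vertices.
  d : Fin (2 * n) → Fin (2 + 2 * n)
  d i = punchIn α (punchIn β′ i)

  d≢α : ∀ i → d i ≢ α
  d≢α i = Fin.punchInᵢ≢i α (punchIn β′ i)

  d≢β : ∀ i → d i ≢ β
  d≢β i eq = Fin.punchInᵢ≢i β′ i (Fin.punchIn-injective α _ _ (trans eq (sym β′≡β)))

  d-injective : ∀ {i k} → d i ≡ d k → i ≡ k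
  d-injective eq = Fin.punchIn-injective β′ _ _ (Fin.punchIn-injective α _ _ eq)

  d-cover : ∀ u → u ≡ α ⊎ u ≡ β ⊎ ∃[ i ] d i ≡ u
  d-cover u with u Fin.≟ α
  ... | yes u≡α = inj₁ u≡α
  ... | no  u≢α with punchOut (u≢α ∘ sym) in eq
  ...   | u′ with u′ Fin.≟ β′
  ...     | yes refl = inj₂ (inj₁ (trans
              (trans (sym (Fin.punchIn-punchOut (u≢α ∘ sym))) (cong (punchIn α) eq)) β′≡β))
  ...     | no u′≢β′ = inj₂ (inj₂ (punchOut (u′≢β′ ∘ sym) , trans
              (cong (punchIn α) (trans (Fin.punchIn-punchOut (u′≢β′ ∘ sym)) (sym eq)))
              (Fin.punchIn-punchOut (u≢α ∘ sym))))

  d-sum : ∀ g → sum g ≡ g α + (g β + sum (g ∘ d))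
  d-sum g = trans (sum-remove₂ α β′ g) (cong (λ v → g α + (g v + sum (g ∘ d))) β′≡β)

  χ : Fin (2 + 2 * n) → Fin (2 + 2 * n) → ℕ
  χ = adjacency G

  -- The degree of a vertex of D in three parts: its edges to `α` and to `β`, and its degree inside
  -- D.
  A B R : Fin (2 * n) → ℕ
  A i = χ (d i) α
  B i = χ (d i) β
  R i = sum (λ k → χ (d i) (d k))

  A+B+R : ∀ i → A i + (B i + R i) ≡ 2
  A+B+R i = trans (sym (d-sum (χ (d i)))) (deg-rest (d≢α i) (d≢β i))

  ∑A : χ α β + sum A ≡ n + 1
  ∑A = begin
    χ α β + sum A
      ≡⟨ cong (χ α β +_) (sum-cong-≗ {2 * n} λ i → adjacency-sym G (d i) α) ⟩
    χ α β + sum (χ α ∘ d)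
      ≡⟨ cong (_+ (χ α β + sum (χ α ∘ d))) (adjacency-0 G (irrefl G {α})) ⟨
    χ α α + (χ α β + sum (χ α ∘ d))            ≡⟨ d-sum (χ α) ⟨
    deg G α                                    ≡⟨ deg-hub₁ ⟩
    n + 1                                      ∎
    where open ≡-Reasoning

  ∑B : χ α β + sum B ≡ n + 1
  ∑B = begin
    χ α β + sum B
      ≡⟨ cong₂ _+_ (adjacency-sym G α β) (sum-cong-≗ {2 * n} λ i → adjacency-sym G (d i) β) ⟩
    χ β α + sum (χ β ∘ d)
      ≡⟨ cong (λ x → χ β α + (x + sum (χ β ∘ d))) (adjacency-0 G (irrefl G {β})) ⟨
    χ β α + (χ β β + sum (χ β ∘ d))            ≡⟨ d-sum (χ β) ⟨
    deg G β                                    ≡⟨ deg-hub₂ ⟩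
    n + 1                                      ∎
    where open ≡-Reasoning

  ∑ABR : sum A + (sum B + sum R) ≡ 2 * n * 2
  ∑ABR = begin
    sum A + (sum B + sum R)          ≡⟨ cong (sum A +_) (∑-distrib-+ B R) ⟨
    sum A + sum (λ i → B i + R i)    ≡⟨ ∑-distrib-+ A (λ i → B i + R i) ⟨
    sum (λ i → A i + (B i + R i))    ≡⟨ sum-cong-≗ {2 * n} A+B+R ⟩
    sum {2 * n} (const 2)            ≡⟨ sum-const (2 * n) 2 ⟩
    2 * n * 2                        ∎
    where open ≡-Reasoning

  -- With the edge between the hubs set aside, each hub has `n` neighbours in D. The degrees in D
  -- total 4n, which leaves 2n for the degrees inside D.
  ∑R : χ α β ≡ 1 → sum R ≡ 2 * n
  ∑R e≡1 = +-cancelˡ-≡ (2 * n) _ _ (begin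
    2 * n + sum R                    ≡⟨ cong (λ x → n + x + sum R) (+-identityʳ n) ⟩
    n + n + sum R                    ≡⟨ +-assoc n n _ ⟩
    n + (n + sum R)                  ≡⟨ cong₂ (λ x y → x + (y + sum R)) (size ∑A) (size ∑B) ⟨
    sum A + (sum B + sum R)          ≡⟨ ∑ABR ⟩
    2 * n * 2                        ≡⟨ double n ⟩
    2 * n + 2 * n                    ∎)
    where
    open ≡-Reasoning
    double : ∀ n → 2 * n * 2 ≡ 2 * n + 2 * n
    double = solve-∀
    size : ∀ {s} → χ α β + s ≡ n + 1 → s ≡ n
    size {s} eq = suc-injective (trans (cong (_+ s) (sym e≡1)) (trans eq (+-comm n 1)))

  Inner : Set
  Inner = ∀ {u} → u ≢ α → u ≢ β → ∃[ w ] (w ≢ α × w ≢ β × Adj G u w)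

  1≤R : Inner → ∀ i → 1 ≤ R i
  1≤R inner i with inner (d≢α i) (d≢β i)
  ... | w , w≢α , w≢β , i~w with d-cover w
  ...   | inj₁ w≡α = contradiction w≡α w≢α
  ...   | inj₂ (inj₁ w≡β) = contradiction w≡β w≢β
  ...   | inj₂ (inj₂ (k , refl)) = begin
    1                                       ≡⟨ adjacency-1 G i~w ⟨
    χ (d i) (d k)                           ≤⟨ term-≤-sum (χ (d i) ∘ d) k ⟩
    R i                                     ∎
    where open ≤-Reasoning

  -- Otherwise both hubs would send all their n + 1 edges into D. With at least one inner neighbour
  -- for each of the 2n vertices of D, the degrees in D would total at least 4n + 2, but they total
  -- 4n.
  hubs-adjacent : χ α β ≡ 1
  hubs-adjacent with tight
  ... | inj₁ (_ , α~β) = adjacency-1 G α~β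
  ... | inj₂ inner with _~?_ G α β
  ...   | yes _   = refl
  ...   | no  α≁β = contradiction ∑ABR (>⇒≢ too-large)
    where
    open ≤-Reasoning
    e≡0 : χ α β ≡ 0
    e≡0 = adjacency-0 G α≁β
    too-large : 2 * n * 2 < sum A + (sum B + sum R)
    too-large = begin-strict
      2 * n * 2                        ≡⟨ double n ⟩
      n + (n + 2 * n * 1)              <⟨ +-mono-< n<n+1 (+-monoˡ-< (2 * n * 1) n<n+1) ⟩
      n + 1 + (n + 1 + 2 * n * 1)
        ≡⟨ cong₂ (λ x y → x + (y + 2 * n * 1)) (size ∑A) (size ∑B) ⟨
      sum A + (sum B + 2 * n * 1)      ≡⟨ cong (λ x → sum A + (sum B + x)) (sum-const (2 * n) 1) ⟨
      sum A + (sum B + sum {2 * n} (const 1))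
        ≤⟨ +-monoʳ-≤ (sum A) (+-monoʳ-≤ (sum B) (sum-mono-≤ (1≤R inner))) ⟩
      sum A + (sum B + sum R)          ∎
      where
      n<n+1 : n < n + 1
      n<n+1 = ≤-reflexive (+-comm 1 n)
      size : ∀ {s} → χ α β + s ≡ n + 1 → s ≡ n + 1
      size {s} eq = trans (cong (_+ s) (sym e≡0)) eq
      double : ∀ n → 2 * n * 2 ≡ n + (n + 2 * n * 1)
      double = solve-∀

  -- The sum of `R` equals the number 2n of its terms, so a bound by 1 on one side makes every term
  -- 1. The inner neighbours give the lower bound; for `n` equal to 1, D has only two vertices,
  -- which gives the upper bound.
  R≡1 : ∀ i → R i ≡ 1
  R≡1 with tight
  ... | inj₂ inner = λ i → sym (sum-≤-≡ (1≤R inner)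
    (≤-reflexive (trans (∑R hubs-adjacent) (trans (sym (*-identityʳ (2 * n))) (sym (sum-const (2 * n) 1))))) i)
  ... | inj₁ (refl , _) = sum-≤-≡ R≤1 (≤-reflexive (sym (∑R hubs-adjacent)))
    where
    R≤1 : ∀ i → R i ≤ 1
    R≤1 i = begin
      R i  ≡⟨ sum-remove {i = i} (χ (d i) ∘ d) ⟩
      χ (d i) (d i) + sum {1} (χ (d i) ∘ d ∘ punchIn i)
        ≤⟨ +-mono-≤ (≤-reflexive (adjacency-0 G (irrefl G {d i})))
             (sum-mono-≤ {1} {_} {const 1} λ k → adjacency-≤1 G (d i) (d (punchIn i k))) ⟩
      1  ∎
      where open ≤-Reasoning

  A+B : ∀ i → A i + B i ≡ 1
  A+B i = +-cancelʳ-≡ 1 _ _ (begin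
    A i + B i + 1      ≡⟨ cong (A i + B i +_) (R≡1 i) ⟨
    A i + B i + R i    ≡⟨ +-assoc (A i) _ _ ⟩
    A i + (B i + R i)  ≡⟨ A+B+R i ⟩
    2                  ∎)
    where open ≡-Reasoning

  exclusive : ∀ {i} → Adj G (d i) α → ¬ Adj G (d i) β
  exclusive {i} i~α i~β with () ← trans (sym (cong₂ _+_ (adjacency-1 G i~α) (adjacency-1 G i~β))) (A+B i)

  α-or-β : ∀ i → Adj G (d i) α ⊎ Adj G (d i) β
  α-or-β i with _~?_ G (d i) α
  ... | yes i~α = inj₁ i~α
  ... | no  i≁α = inj₂ (adjacency-1⁻ G (trans (cong (_+ B i) (sym (adjacency-0 G i≁α))) (A+B i)))

  private
    mates : ∀ i → _
    mates i = enumerate (λ k → does (_~?_ G (d i) (d k))) (R≡1 i)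

  -- The one neighbour of a vertex inside D, which exists by `R≡1`; these pairs are the perfect
  -- matching.
  mate : Fin (2 * n) → Fin (2 * n)
  mate i = proj₁ (mates i) zero

  mate-adjacent : ∀ i → Adj G (d i) (d (mate i))
  mate-adjacent i = adjacency-1⁻ G (cong 𝟙 (proj₁ (proj₂ (proj₂ (mates i))) zero))

  mate-unique : ∀ {i k} → Adj G (d i) (d k) → k ≡ mate i
  mate-unique {i} {k} i~k with proj₂ (proj₂ (proj₂ (mates i))) k (dec-true (_~?_ G (d i) (d k)) i~k)
  ... | zero , eq = sym eq

  mate-involutive : ∀ i → mate (mate i) ≡ i
  mate-involutive i = sym (mate-unique (~-sym G (mate-adjacent i)))

  mate-injective : ∀ {i k} → mate i ≡ mate k → i ≡ k
  mate-injective {i} {k} eq = trans (sym (mate-involutive i)) (trans (cong mate eq) (mate-involutive k))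

  -- If both vertices of a matched pair hang on the hub s, then deleting s
  -- cuts the pair off from the other hub t.
  mates-split : ∀ {s t} → t ≢ s → (∀ u → u ≡ s ⊎ u ≡ t ⊎ ∃[ i ] d i ≡ u) →
                (∀ {i} → d i ≢ s) → (∀ {i} → d i ≢ t) →
                (∀ {i} → Adj G (d i) s → ¬ Adj G (d i) t) →
                ∀ {i} → Adj G (d i) s → ¬ Adj G (d (mate i)) s
  mates-split {s} {t} t≢s cover d≢s d≢t excl {i} i~s m~s
    with closed⇒unreachable G (λ u → u ≡ d i ⊎ u ≡ d (mate i)) closed (inj₁ refl)
           (biconnected s (d i , outside-s d≢s) (t , outside-s t≢s))
    where
    outside-s : ∀ {u} → u ≢ s → u ∈ ∁ ⁅ s ⁆
    outside-s u≢s = x∉p⇒x∈∁p (x≢y⇒x∉⁅y⁆ u≢s)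
    -- Without `s`, a vertex of D hanging on `s` keeps only its mate: `excl` rules out `t`.
    closed-at : ∀ {k v} → Adj G (d k) s → v ∈ ∁ ⁅ s ⁆ → Adj G (d k) v → v ≡ d (mate k)
    closed-at {v = v} k~s v∈ k~v with cover v
    ... | inj₁ refl               = contradiction (x∈⁅x⁆ s) (x∈∁p⇒x∉p v∈)
    ... | inj₂ (inj₁ refl)        = contradiction k~v (excl k~s)
    ... | inj₂ (inj₂ (l , refl))  = cong d (mate-unique k~v)
    closed : ∀ {u v} → u ≡ d i ⊎ u ≡ d (mate i) → v ∈ ∁ ⁅ s ⁆ → Adj G u v → v ≡ d i ⊎ v ≡ d (mate i)
    closed (inj₁ refl) v∈ u~v = inj₂ (closed-at i~s v∈ u~v)
    closed (inj₂ refl) v∈ u~v = inj₁ (trans (closed-at m~s v∈ u~v) (cong d (mate-involutive i)))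
  ... | inj₁ eq = d≢t (sym eq)
  ... | inj₂ eq = d≢t (sym eq)

  mate-β : ∀ {i} → Adj G (d i) α → Adj G (d (mate i)) β
  mate-β {i} i~α with α-or-β (mate i)
  ... | inj₂ m~β = m~β
  ... | inj₁ m~α = contradiction m~α
    (mates-split (α≢β ∘ sym) d-cover (d≢α _) (d≢β _) exclusive i~α)

  mate-α : ∀ {i} → Adj G (d i) β → Adj G (d (mate i)) α
  mate-α {i} i~β with α-or-β (mate i)
  ... | inj₁ m~α = m~α
  ... | inj₂ m~β = contradiction m~β
    (mates-split α≢β cover′ (d≢β _) (d≢α _) (λ i~β i~α → exclusive i~α i~β) i~β)
    where
    cover′ : ∀ u → u ≡ β ⊎ u ≡ α ⊎ ∃[ i ] d i ≡ u
    cover′ u with d-cover u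
    ... | inj₁ u≡α        = inj₂ (inj₁ u≡α)
    ... | inj₂ (inj₁ u≡β) = inj₁ u≡β
    ... | inj₂ (inj₂ u≡d) = inj₂ (inj₂ u≡d)

  private
    pages : _
    pages = enumerate (λ i → does (_~?_ G (d i) α))
      -- `∑A` also counts the edge between the hubs; without it `n` neighbours of `α` remain in D.
      (suc-injective (trans (cong (_+ sum A) (sym hubs-adjacent)) (trans ∑A (+-comm n 1))))

  -- The vertices of D hanging on `α`, one per page; their mates will be the other ends of the
  -- pages.
  leaf : Fin n → Fin (2 * n)
  leaf = proj₁ pages

  leaf-injective : ∀ {i k} → leaf i ≡ leaf k → i ≡ k
  leaf-injective = proj₁ (proj₂ pages)

  leaf~α : ∀ i → Adj G (d (leaf i)) α
  leaf~α i = adjacency-1⁻ G (cong 𝟙 (proj₁ (proj₂ (proj₂ pages)) i))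

  leaf-complete : ∀ {k} → Adj G (d k) α → ∃[ i ] leaf i ≡ k
  leaf-complete {k} k~α = proj₂ (proj₂ (proj₂ pages)) k (dec-true (_~?_ G (d k) α) k~α)

  leaf≢mate : ∀ {i k} → leaf i ≢ mate (leaf k)
  leaf≢mate {i} {k} eq = exclusive (leaf~α i) (subst (λ x → Adj G (d x) β) (sym eq) (mate-β (leaf~α k)))

  ψ : BookVertex n → Fin (2 + 2 * n)
  ψ (spine a)  = α
  ψ (spine b)  = β
  ψ (page i a) = d (leaf i)
  ψ (page i b) = d (mate (leaf i))

  ψ-injective : ∀ x y → ψ x ≡ ψ y → x ≡ y
  ψ-injective (spine a)  (spine a)  eq = refl
  ψ-injective (spine a)  (spine b)  eq = contradiction eq α≢β
  ψ-injective (spine b)  (spine a)  eq = contradiction (sym eq) α≢β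
  ψ-injective (spine b)  (spine b)  eq = refl
  ψ-injective (spine a)  (page i a) eq = contradiction (sym eq) (d≢α _)
  ψ-injective (spine a)  (page i b) eq = contradiction (sym eq) (d≢α _)
  ψ-injective (spine b)  (page i a) eq = contradiction (sym eq) (d≢β _)
  ψ-injective (spine b)  (page i b) eq = contradiction (sym eq) (d≢β _)
  ψ-injective (page i a) (spine a)  eq = contradiction eq (d≢α _)
  ψ-injective (page i b) (spine a)  eq = contradiction eq (d≢α _)
  ψ-injective (page i a) (spine b)  eq = contradiction eq (d≢β _)
  ψ-injective (page i b) (spine b)  eq = contradiction eq (d≢β _)
  ψ-injective (page i a) (page k a) eq = cong (λ i → page i a) (leaf-injective (d-injective eq))
  ψ-injective (page i a) (page k b) eq = contradiction (d-injective eq) leaf≢mate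
  ψ-injective (page i b) (page k a) eq = contradiction (sym (d-injective eq)) leaf≢mate
  ψ-injective (page i b) (page k b) eq = cong (λ i → page i b) (leaf-injective (mate-injective (d-injective eq)))

  -- A vertex of D on `α` is a leaf; one on `β` has a leaf as its mate, and `mate` is an involution.
  ψ-surjective : ∀ u → ∃[ x ] ψ x ≡ u
  ψ-surjective u with d-cover u
  ... | inj₁ refl              = spine a , refl
  ... | inj₂ (inj₁ refl)       = spine b , refl
  ... | inj₂ (inj₂ (k , refl)) with α-or-β k
  ...   | inj₁ k~α with leaf-complete k~α
  ...     | i , refl = page i a , refl
  ψ-surjective u | inj₂ (inj₂ (k , refl)) | inj₂ k~β with leaf-complete (mate-α k~β)
  ...     | i , eq = page i b , cong d (trans (cong mate eq) (mate-involutive k))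

  α~β : Adj G α β
  α~β = adjacency-1⁻ G hubs-adjacent

  preserves-edge : ∀ {x y} → BookEdge x y → Adj G (ψ x) (ψ y)
  preserves-edge ab        = α~β
  preserves-edge (a-ia i)  = ~-sym G (leaf~α i)
  preserves-edge (ia-ib i) = mate-adjacent (leaf i)
  preserves-edge (ib-b i)  = mate-β (leaf~α i)

  preserves : ∀ {x y} → Adj (Book n) x y → Adj G (ψ x) (ψ y)
  preserves (fwd e) = preserves-edge e
  preserves (bwd e) = ~-sym G (preserves-edge e)

  reflects-spine-page : ∀ s i t → Adj G (ψ (spine s)) (ψ (page i t)) → Adj (Book n) (spine s) (page i t)
  reflects-spine-page a i a u~v = fwd (a-ia i)
  reflects-spine-page a i b u~v = contradiction (mate-β (leaf~α i)) (exclusive (~-sym G u~v))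
  reflects-spine-page b i a u~v = contradiction (~-sym G u~v) (exclusive (leaf~α i))
  reflects-spine-page b i b u~v = bwd (ib-b i)

  reflects-a-b : ∀ i k → Adj G (ψ (page i a)) (ψ (page k b)) → Adj (Book n) (page i a) (page k b)
  reflects-a-b i k u~v with leaf-injective (mate-injective (mate-unique u~v))
  ... | refl = fwd (ia-ib i)

  reflects : ∀ x y → Adj G (ψ x) (ψ y) → Adj (Book n) x y
  reflects (spine a)  (spine a)  u~v = contradiction u~v (irrefl G)
  reflects (spine a)  (spine b)  u~v = fwd ab
  reflects (spine b)  (spine a)  u~v = bwd ab
  reflects (spine b)  (spine b)  u~v = contradiction u~v (irrefl G)
  reflects (spine s)  (page i t) u~v = reflects-spine-page s i t u~v
  reflects (page i s) (spine t)  u~v = ~-sym (Book n) (reflects-spine-page t i s (~-sym G u~v))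
  -- The only neighbour of a leaf in D is its mate, which is not a leaf; so no two leaves are
  -- adjacent.
  reflects (page i a) (page k a) u~v = contradiction (mate-unique u~v) leaf≢mate
  reflects (page i a) (page k b) u~v = reflects-a-b i k u~v
  reflects (page i b) (page k a) u~v = ~-sym (Book n) (reflects-a-b k i (~-sym G u~v))
  reflects (page i b) (page k b) u~v =
    contradiction (trans (sym (mate-involutive (leaf i))) (sym (mate-unique u~v))) leaf≢mate

  isomorphic : G ≅ Book n
  isomorphic = mk↔ₛ′ inv ψ (λ x → ψ-injective _ _ (ψ-inv (ψ x))) ψ-inv , λ u v → mk⇔
    (λ u~v → reflects _ _ (subst₂ (Adj G) (sym (ψ-inv u)) (sym (ψ-inv v)) u~v))
    (λ e → subst₂ (Adj G) (ψ-inv u) (ψ-inv v) (preserves e))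
    where
    inv : Fin (2 + 2 * n) → BookVertex n
    inv u = proj₁ (ψ-surjective u)
    ψ-inv : ∀ u → ψ (inv u) ≡ u
    ψ-inv u = proj₂ (ψ-surjective u)

-- From the coefficients to two hubs.

vertex-count : ∀ {n N} (G : SimpleGraph (Fin N)) →
               [x^ 1 ] (da G) ≈ 2 ·y^ (n + 1) ⊕ (2 * n) ·y^ (2 * n) → N ≡ 2 + 2 * n
vertex-count {n} {N} G c₁ = begin
  N                                                      ≡⟨ *-identityʳ N ⟨
  N * 1                                                  ≡⟨ sum-const N 1 ⟨
  -- Each vertex contributes one monomial to the coefficient of x, so the value of that coefficient
  -- at y = 1 is the number of vertices.
  sum {N} (const 1)
    ≡⟨ sum-cong-≗ {N} (λ u → sum-·y^ 1 (N ∸ deg G u) (below u)) ⟨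
  sum {N} (λ u → sum {m} λ j → (1 ·y^ (N ∸ deg G u)) (toℕ j))
    ≡⟨ ∑-comm {N} {m} (λ u j → (1 ·y^ (N ∸ deg G u)) (toℕ j)) ⟩
  sum {m} (λ j → sum {N} λ u → (1 ·y^ (N ∸ deg G u)) (toℕ j))
    ≡⟨ sum-cong-≗ {m} (λ j → trans (sym (coefficient-1 G (toℕ j))) (c₁ (toℕ j))) ⟩
  sum {m} (λ j → (2 ·y^ (n + 1)) (toℕ j) + ((2 * n) ·y^ (2 * n)) (toℕ j))
    ≡⟨ ∑-distrib-+ {m} (λ j → (2 ·y^ (n + 1)) (toℕ j)) (λ j → ((2 * n) ·y^ (2 * n)) (toℕ j)) ⟩
  sum {m} (λ j → (2 ·y^ (n + 1)) (toℕ j)) + sum {m} (λ j → ((2 * n) ·y^ (2 * n)) (toℕ j))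
    ≡⟨ cong₂ _+_ (sum-·y^ 2 (n + 1) below₁) (sum-·y^ (2 * n) (2 * n) below₂) ⟩
  2 + 2 * n                                              ∎
  where
  open ≡-Reasoning
  m : ℕ
  -- Exceeds all exponents on both sides, so that the first `m` coefficients give the value at y =
  -- 1.
  m = suc (N + ((n + 1) + 2 * n))
  below : ∀ u → N ∸ deg G u < m
  below u = s≤s (≤-trans (m∸n≤m N (deg G u)) (m≤m+n N _))
  below₁ : n + 1 < m
  below₁ = s≤s (≤-trans (m≤m+n (n + 1) (2 * n)) (m≤n+m _ N))
  below₂ : 2 * n < m
  below₂ = s≤s (≤-trans (m≤n+m (2 * n) (n + 1)) (m≤n+m _ N))

-- A vertex where G − v attains its minimum |V(G)| has as many neighbours in
-- G − v as it has in {v}.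
light-neighbour : ∀ {N} (G : SimpleGraph (Fin N)) → (∀ u → 2 ≤ deg G u) →
                  ∀ {v u} → u ∈ ∁ ⁅ v ⁆ → f G (∁ ⁅ v ⁆) ≡ N → ∃[ w ] (Adj G v w × deg G w ≡ 2)
light-neighbour {N} G 2≤deg {v} {u} u∈ f≡N with f-attained G u∈
... | w , w∈ , f≡score = w , ~-sym G w~v , deg≡2
  where
  open ≡-Reasoning
  χ δ′ : ℕ
  χ  = adjacency G w v
  δ′ = δ G (∁ ⁅ v ⁆) w
  -- Ensures that `∸` in the score does not truncate; that `N` is not 0 comes from the degree of
  -- `w`.
  χ≤N : χ ≤ N
  χ≤N = ≤-trans (adjacency-≤1 G w v) (≤-trans (s≤s z≤n) (≤-trans (2≤deg w) (deg-≤ G w)))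
  δ+N≡χ+N : δ′ + N ≡ χ + N
  δ+N≡χ+N = begin
    δ′ + N               ≡⟨ m∸n+n≡m (≤-trans χ≤N (m≤n+m N δ′)) ⟨
    (δ′ + N) ∸ χ + χ
      ≡⟨ cong (_+ χ) (trans (sym (score-coatom G w v)) (trans (sym f≡score) f≡N)) ⟩
    N + χ                ≡⟨ +-comm N χ ⟩
    χ + N                ∎
  deg≡χ+χ : deg G w ≡ χ + χ
  deg≡χ+χ = trans (sym (δ-coatom G w v)) (cong (_+ χ) (+-cancelʳ-≡ N _ _ δ+N≡χ+N))
  w~v : Adj G w v
  w~v with _~?_ G w v
  ... | yes p = p
  ... | no ¬p = contradiction (≤-trans (2≤deg w) (≤-reflexive
                  (trans deg≡χ+χ (cong (λ x → x + x) (adjacency-0 G ¬p))))) λ ()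
  deg≡2 : deg G w ≡ 2
  deg≡2 = trans deg≡χ+χ (cong (λ x → x + x) (adjacency-1 G w~v))

-- The `N` sets `∁ ⁅ v ⁆` contribute at most 1 each to the coefficient of y^(2n+2), which is 2n + 2,
-- that is, `N`. So each contributes exactly 1.
coatoms : ∀ {n N} → N ≡ 2 + 2 * n → (G : SimpleGraph (Fin N)) →
          [x^ 2 * n + 1 ] (da G) ≈ (2 * n + 2) ·y^ (2 * n + 2) →
          ∀ v → Admissible G (∁ ⁅ v ⁆) × f G (∁ ⁅ v ⁆) ≡ N
coatoms {n} {N} order G c₃ v = proj₁ p , trans (proj₂ p) (sym order′)
  where
  open ≡-Reasoning
  order′ : N ≡ 2 * n + 2
  order′ = trans order (+-comm 2 (2 * n))
  all-1 : ∀ v → weight G (2 * n + 2) (∁ ⁅ v ⁆) ≡ 1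
  all-1 = sum-≤-≡ {N} (λ v → weight-≤1 G (2 * n + 2) (∁ ⁅ v ⁆)) (≤-reflexive (begin
    sum {N} (const 1)                              ≡⟨ sum-const N 1 ⟩
    N * 1                                          ≡⟨ *-identityʳ N ⟩
    N                                              ≡⟨ order′ ⟩
    2 * n + 2                                      ≡⟨ ·y^-≡ (2 * n + 2) (2 * n + 2) ⟨
    ((2 * n + 2) ·y^ (2 * n + 2)) (2 * n + 2)      ≡⟨ c₃ (2 * n + 2) ⟨
    [x^ 2 * n + 1 ] (da G) (2 * n + 2)
      ≡⟨ coefficient-coatom G (trans (cong suc (+-comm (2 * n) 1)) (sym order)) (2 * n + 2) ⟩
    sum (λ v → weight G (2 * n + 2) (∁ ⁅ v ⁆))     ∎))
  p : Admissible G (∁ ⁅ v ⁆) × f G (∁ ⁅ v ⁆) ≡ 2 * n + 2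
  p = weight-1⁻ G {2 * n + 2} {∁ ⁅ v ⁆} (all-1 v)

module Degrees {n : ℕ} .{{_ : NonZero n}} {N : ℕ} (order : N ≡ 2 + 2 * n) (G : SimpleGraph (Fin N))
  (sum-degrees : ∀ j → sum (λ u → (1 ·y^ (N ∸ deg G u)) j) ≡
                       (2 ·y^ (n + 1) ⊕ (2 * n) ·y^ (2 * n)) j) where

  1≤N : 1 ≤ N
  1≤N = ≤-trans (s≤s z≤n) (≤-reflexive (sym order))

  codegree⇒degree : ∀ {u k} → N ∸ deg G u ≡ k → deg G u ≡ N ∸ k
  codegree⇒degree {u} refl = sym (m∸[m∸n]≡n (deg-≤ G u))

  N∸[n+1] : N ∸ (n + 1) ≡ n + 1
  N∸[n+1] = trans (cong (_∸ (n + 1)) (trans order (halves n))) (m+n∸n≡m (n + 1) (n + 1))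
    where
    halves : ∀ n → 2 + 2 * n ≡ (n + 1) + (n + 1)
    halves = solve-∀

  N∸2n : N ∸ 2 * n ≡ 2
  N∸2n = trans (cong (_∸ 2 * n) order) (m+n∸n≡m 2 (2 * n))

  -- The vertex `u` contributes 1 at its own exponent, so the coefficient there is nonzero and the
  -- exponent is one of the two present.
  degrees : ∀ u → N ∸ deg G u ≡ n + 1 ⊎ N ∸ deg G u ≡ 2 * n
  degrees u with n + 1 ≟ N ∸ deg G u | 2 * n ≟ N ∸ deg G u
  ... | yes eq | _      = inj₁ (sym eq)
  ... | no  _  | yes eq = inj₂ (sym eq)
  ... | no ne₁ | no ne₂ = contradiction (begin
    1                                                      ≡⟨ ·y^-≡ 1 (N ∸ deg G u) ⟨
    (1 ·y^ (N ∸ deg G u)) (N ∸ deg G u)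
      ≤⟨ term-≤-sum (λ v → (1 ·y^ (N ∸ deg G v)) (N ∸ deg G u)) u ⟩
    sum (λ v → (1 ·y^ (N ∸ deg G v)) (N ∸ deg G u))        ≡⟨ sum-degrees (N ∸ deg G u) ⟩
    (2 ·y^ (n + 1) ⊕ (2 * n) ·y^ (2 * n)) (N ∸ deg G u)
      ≡⟨ cong₂ _+_ (·y^-≢ 2 ne₁) (·y^-≢ (2 * n) ne₂) ⟩
    0                                                      ∎) λ ()
    where open ≤-Reasoning

  2≤deg : ∀ u → 2 ≤ deg G u
  2≤deg u with degrees u
  ... | inj₁ eq = ≤-trans (+-monoˡ-≤ 1 (>-nonZero⁻¹ n)) (≤-reflexive (sym (trans (codegree⇒degree eq) N∸[n+1])))
  ... | inj₂ eq = ≤-reflexive (sym (trans (codegree⇒degree eq) N∸2n))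

  module Hubs
    (light  : ∀ v → ∃[ w ] (Adj G v w × deg G w ≡ 2))
    (coatom : ∀ v → Connected (G [ ∁ ⁅ v ⁆ ])) where

    -- Here n + 1 and 2n are the same exponent, so all vertices have degree 2; `light` supplies the
    -- neighbour that becomes the second hub.
    hubs-small : n ≡ 1 → TwoHubs n G
    hubs-small n≡1 with light (fromℕ< 1≤N)
    ... | w , 0~w , _ = record
      { hub₁ = fromℕ< 1≤N
      ; hub₂ = w
      ; hub₁≢hub₂ = λ eq → irrefl G (subst (Adj G _) (sym eq) 0~w)
      ; deg-hub₁ = trans (deg≡2 (fromℕ< 1≤N)) 2≡n+1
      ; deg-hub₂ = trans (deg≡2 w) 2≡n+1
      ; deg-rest = λ {u} _ _ → deg≡2 u
      ; tight = inj₁ (n≡1 , 0~w)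
      ; biconnected = coatom
      }
      where
      2≡n+1 : 2 ≡ n + 1
      2≡n+1 = cong (_+ 1) (sym n≡1)
      deg≡2 : ∀ u → deg G u ≡ 2
      deg≡2 u with degrees u
      ... | inj₁ eq = trans (codegree⇒degree eq) (trans N∸[n+1] (sym 2≡n+1))
      ... | inj₂ eq = trans (codegree⇒degree eq) N∸2n

    -- The exponents n + 1 and 2n now differ, so the coefficient at y^(n+1) is 2 and counts the
    -- vertices of degree n + 1.
    hubs-large : n ≢ 1 → TwoHubs n G
    hubs-large n≢1 with enumerate (λ u → does (N ∸ deg G u ≟ n + 1)) two-hubs
      where
      open ≡-Reasoning
      two-hubs : sum (λ u → 𝟙 (does (N ∸ deg G u ≟ n + 1))) ≡ 2
      two-hubs = begin
        sum (λ u → 𝟙 (does (N ∸ deg G u ≟ n + 1)))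
          ≡⟨ sum-cong-≗ {N} (λ u → 𝟙-if (does (N ∸ deg G u ≟ n + 1))) ⟩
        sum (λ u → (1 ·y^ (N ∸ deg G u)) (n + 1))            ≡⟨ sum-degrees (n + 1) ⟩
        (2 ·y^ (n + 1) ⊕ (2 * n) ·y^ (2 * n)) (n + 1)
          ≡⟨ cong₂ _+_ (·y^-≡ 2 (n + 1)) (·y^-≢ (2 * n) 2n≢n+1) ⟩
        2                                                    ∎
        where
        𝟙-if : ∀ p → 𝟙 p ≡ (if p then 1 else 0)
        𝟙-if true  = refl
        𝟙-if false = refl
        2n≢n+1 : 2 * n ≢ n + 1
        2n≢n+1 eq = n≢1 (trans (sym (+-identityʳ n)) (+-cancelˡ-≡ n _ _ eq))
    ... | e , e-injective , sound , complete = record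
      { hub₁ = e zero
      ; hub₂ = e (suc zero)
      ; hub₁≢hub₂ = λ eq → Fin.0≢1+n (e-injective eq)
      ; deg-hub₁ = deg-hub zero
      ; deg-hub₂ = deg-hub (suc zero)
      ; deg-rest = deg-rest
      ; tight = inj₂ λ {u} _ _ → inner u
      ; biconnected = coatom
      }
      where
      codeg-hub : ∀ i → N ∸ deg G (e i) ≡ n + 1
      codeg-hub i = 𝟙-does⁻ (N ∸ deg G (e i) ≟ n + 1) (cong 𝟙 (sound i))
      deg-hub : ∀ i → deg G (e i) ≡ n + 1
      deg-hub i = trans (codegree⇒degree (codeg-hub i)) N∸[n+1]
      deg-rest : ∀ {u} → u ≢ e zero → u ≢ e (suc zero) → deg G u ≡ 2
      deg-rest {u} u≢₁ u≢₂ with degrees u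
      ... | inj₂ eq = trans (codegree⇒degree eq) N∸2n
      ... | inj₁ eq with complete u (dec-true (N ∸ deg G u ≟ n + 1) eq)
      ...   | zero     , refl = contradiction refl u≢₁
      ...   | suc zero , refl = contradiction refl u≢₂
      -- A vertex of degree 2 is no hub, since n + 1 is not 2; thus the neighbour given by `light`
      -- is not a hub.
      deg≡2⇒≢ : ∀ {w} i → deg G w ≡ 2 → w ≢ e i
      deg≡2⇒≢ i eq refl = n≢1 (+-cancelʳ-≡ 1 n 1 (trans (sym (deg-hub i)) eq))
      inner : ∀ u → ∃[ w ] (w ≢ e zero × w ≢ e (suc zero) × Adj G u w)
      inner u with light u
      ... | w , u~w , deg≡2 = w , deg≡2⇒≢ zero deg≡2 , deg≡2⇒≢ (suc zero) deg≡2 , u~w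

    hubs : TwoHubs n G
    hubs with n ≟ 1
    ... | yes n≡1 = hubs-small n≡1
    ... | no  n≢1 = hubs-large n≢1

coefficients⇒book : ∀ n .{{_ : NonZero n}} {N} (G : SimpleGraph (Fin N)) →
  [x^ 1 ] (da G) ≈ 2 ·y^ (n + 1) ⊕ (2 * n) ·y^ (2 * n) →
  [x^ 2 * n + 1 ] (da G) ≈ (2 * n + 2) ·y^ (2 * n + 2) →
  G ≅ Book n
coefficients⇒book n {N} G c₁ c₃ = hubs⇒book order (Hubs.hubs light (proj₂ ∘ proj₁ ∘ coatom))
  where
  order : N ≡ 2 + 2 * n
  order = vertex-count {n} G c₁
  coatom : ∀ v → Admissible G (∁ ⁅ v ⁆) × f G (∁ ⁅ v ⁆) ≡ N
  coatom = coatoms {n} order G c₃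
  open Degrees order G (λ j → trans (sym (coefficient-1 G j)) (c₁ j))
  light : ∀ v → ∃[ w ] (Adj G v w × deg G w ≡ 2)
  light v = light-neighbour G 2≤deg (proj₂ (proj₁ (proj₁ (coatom v)))) (proj₂ (coatom v))
  -- Stated for variable `N` and `G` so that `order` can be matched with `refl`: `FromHubs` is about
  -- graphs on `Fin (2 + 2 * n)`.
  hubs⇒book : ∀ {N} {G : SimpleGraph (Fin N)} → N ≡ 2 + 2 * n → TwoHubs n G → G ≅ Book n
  hubs⇒book refl H = FromHubs.isomorphic H

-- Sums over the vertices of the book.

sum-splitAt : ∀ m {n} (g : Fin m ⊎ Fin n → ℕ) →
              sum (g ∘ splitAt m) ≡ sum (g ∘ inj₁) + sum (g ∘ inj₂)
sum-splitAt zero    g = refl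
sum-splitAt (suc m) {n} g = trans (cong (g (inj₁ zero) +_) (sum-splitAt m {n} (g ∘ Sum.map₁ suc)))
  (sym (+-assoc (g (inj₁ zero)) _ _))

pageAt : ∀ {n} → Fin n ⊎ Fin n → BookVertex n
pageAt (inj₁ i) = page i a
pageAt (inj₂ i) = page i b

-- The size is written with `n + n` so that `splitAt n` separates the two sides of the pages.
bookVertices : ∀ n → Fin (2 + (n + n)) ↔ BookVertex n
bookVertices n = mk↔ₛ′ to from to-from from-to
  where
  to : Fin (2 + (n + n)) → BookVertex n
  to zero          = spine a
  to (suc zero)    = spine b
  to (suc (suc i)) = pageAt (splitAt n i)
  from : BookVertex n → Fin (2 + (n + n))
  from (spine a)  = zero
  from (spine b)  = suc zero
  from (page i a) = suc (suc (i ↑ˡ n))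
  from (page i b) = suc (suc (n ↑ʳ i))
  to-from : ∀ x → to (from x) ≡ x
  to-from (spine a)  = refl
  to-from (spine b)  = refl
  to-from (page i a) = cong pageAt (Fin.splitAt-↑ˡ n i n)
  to-from (page i b) = cong pageAt (Fin.splitAt-↑ʳ n n i)
  from-pageAt : ∀ s → from (pageAt s) ≡ suc (suc (join n n s))
  from-pageAt (inj₁ i) = refl
  from-pageAt (inj₂ i) = refl
  from-to : ∀ i → from (to i) ≡ i
  from-to zero          = refl
  from-to (suc zero)    = refl
  from-to (suc (suc i)) = trans (from-pageAt (splitAt n i)) (cong (λ i → suc (suc i)) (Fin.join-splitAt n n i))

module _ {n : ℕ} where

  bookSum : (BookVertex n → ℕ) → ℕ
  bookSum g = g (spine a) + (g (spine b) + (sum (λ i → g (page i a)) + sum (λ i → g (page i b))))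

  bookSum-cong : ∀ {g h} → (∀ x → g x ≡ h x) → bookSum g ≡ bookSum h
  bookSum-cong eq = cong₂ _+_ (eq (spine a)) (cong₂ _+_ (eq (spine b))
    (cong₂ _+_ (sum-cong-≗ {n} λ i → eq (page i a)) (sum-cong-≗ {n} λ i → eq (page i b))))

  sum-bookVertices : ∀ g → sum (g ∘ Inverse.to (bookVertices n)) ≡ bookSum g
  sum-bookVertices g = cong (λ x → g (spine a) + (g (spine b) + x)) (sum-splitAt n (g ∘ pageAt))

  -- `bookVertices` followed by the inverse of `φ` is a bijection of index sets, which keeps the
  -- sum; so the sum along `φ` equals the sum along the standard numbering.
  sum-reindex : ∀ {N} (φ : Fin N ↔ BookVertex n) g → sum (g ∘ Inverse.to φ) ≡ bookSum g
  sum-reindex φ g = begin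
    sum (g ∘ Inverse.to φ)
      ≡⟨ sum-permute (g ∘ Inverse.to φ) π ⟩
    sum (λ i → g (Inverse.to φ (Inverse.from φ (Inverse.to (bookVertices n) i))))
      ≡⟨ sum-cong-≗ {2 + (n + n)} (λ i → cong g (Inverse.strictlyInverseˡ φ (Inverse.to (bookVertices n) i))) ⟩
    sum (g ∘ Inverse.to (bookVertices n))                         ≡⟨ sum-bookVertices g ⟩
    bookSum g                                                     ∎
    where
    open ≡-Reasoning
    π : Fin (2 + (n + n)) ↔ Fin _
    π = ↔-sym φ ↔-∘ bookVertices n

  χᴮ : BookVertex n → BookVertex n → ℕ
  χᴮ = adjacency (Book n)

  neighbourSum : BookVertex n → (BookVertex n → ℕ) → ℕ
  neighbourSum (spine a)  g = g (spine b) + sum (λ i → g (page i a))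
  neighbourSum (spine b)  g = g (spine a) + sum (λ i → g (page i b))
  neighbourSum (page i a) g = g (spine a) + g (page i b)
  neighbourSum (page i b) g = g (spine b) + g (page i a)

  -- `bookEdge?` makes the entries of a row compute to constants, except those between opposite
  -- sides of pages, where the test for equal pages selects a single term.
  bookSum-χ : ∀ x g → bookSum (λ y → χᴮ x y * g y) ≡ neighbourSum x g
  bookSum-χ (spine a)  g = cong₂ _+_ (*-identityˡ (g (spine b))) (trans
    (cong₂ _+_ (sum-cong-≗ {n} λ i → *-identityˡ (g (page i a))) (sum-zero {n} λ _ → refl)) (+-identityʳ _))
  bookSum-χ (spine b)  g = cong₂ _+_ (*-identityˡ (g (spine a)))
    (cong₂ _+_ (sum-zero {n} λ _ → refl) (sum-cong-≗ {n} λ i → *-identityˡ (g (page i b))))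
  bookSum-χ (page i a) g = cong₂ _+_ (*-identityˡ (g (spine a)))
    (cong₂ _+_ (sum-zero {n} λ _ → refl) (trans
      (sum-cong-≗ {n} λ k → cong (λ p → 𝟙 p * g (page k b)) (∨-identityʳ (does (i Fin.≟ k))))
      (sum-select i (λ k → g (page k b)))))
  bookSum-χ (page i b) g = cong₂ _+_ (*-identityˡ (g (spine b))) (trans
    (cong₂ _+_ (trans
      (sum-cong-≗ {n} λ k → cong (λ p → 𝟙 p * g (page k a)) (does-⇔ (mk⇔ sym sym) (k Fin.≟ i) (i Fin.≟ k)))
      (sum-select i (λ k → g (page k a)))) (sum-zero {n} λ _ → refl))
    (+-identityʳ _))

  bookDeg : BookVertex n → ℕ
  bookDeg (spine _)  = n + 1
  bookDeg (page _ _) = 2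

  neighbourSum-1 : ∀ x → neighbourSum x (const 1) ≡ bookDeg x
  neighbourSum-1 (spine a)  = trans (cong suc (trans (sum-const n 1) (*-identityʳ n))) (+-comm 1 n)
  neighbourSum-1 (spine b)  = trans (cong suc (trans (sum-const n 1) (*-identityʳ n))) (+-comm 1 n)
  neighbourSum-1 (page _ a) = refl
  neighbourSum-1 (page _ b) = refl

-- The coefficients of the book.

opp : Side → Side
opp a = b
opp b = a

spine-page : ∀ {n} (i : Fin n) s → Adj (Book n) (spine s) (page i s)
spine-page i a = fwd (a-ia i)
spine-page i b = bwd (ib-b i)

spine-spine : ∀ {n} s → Adj (Book n) (spine s) (spine (opp s))
spine-spine a = fwd ab
spine-spine b = bwd ab

page-page : ∀ {n} (i : Fin n) s → Adj (Book n) (page i s) (page i (opp s))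
page-page i a = fwd (ia-ib i)
page-page i b = bwd (ia-ib i)

book-order : ∀ {n N} → Fin N ↔ BookVertex n → N ≡ 2 + (n + n)
book-order {n} φ = ↔⇒≡ (↔-sym (bookVertices n) ↔-∘ φ)

module FromBook {n : ℕ} .{{_ : NonZero n}} {N : ℕ} (G : SimpleGraph (Fin N)) (iso : G ≅ Book n) where

  private
    order : N ≡ 2 + (n + n)
    order = book-order (proj₁ iso)

    φ : Fin N → BookVertex n
    φ = Inverse.to (proj₁ iso)

    ψ : BookVertex n → Fin N
    ψ = Inverse.from (proj₁ iso)

    φψ : ∀ x → φ (ψ x) ≡ x
    φψ = Inverse.strictlyInverseˡ (proj₁ iso)

    ψφ : ∀ u → ψ (φ u) ≡ u
    ψφ = Inverse.strictlyInverseʳ (proj₁ iso)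

    1≤n : 1 ≤ n
    1≤n = >-nonZero⁻¹ n

    2≤n+1 : 2 ≤ n + 1
    2≤n+1 = +-monoˡ-≤ 1 1≤n

  adj-ψ : ∀ {x y} → Adj (Book n) x y → Adj G (ψ x) (ψ y)
  adj-ψ {x} {y} e = Equivalence.from (proj₂ iso (ψ x) (ψ y))
    (subst₂ (Adj (Book n)) (sym (φψ x)) (sym (φψ y)) e)

  adjacency-φ : ∀ u v → adjacency G u v ≡ χᴮ (φ u) (φ v)
  adjacency-φ u v = cong 𝟙 (does-⇔ (proj₂ iso u v) (_~?_ G u v) (_~?_ (Book n) (φ u) (φ v)))

  deg-φ : ∀ u → deg G u ≡ bookDeg (φ u)
  deg-φ u = begin
    sum (adjacency G u)
      ≡⟨ sum-cong-≗ {N} (λ v → trans (adjacency-φ u v) (sym (*-identityʳ _))) ⟩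
    sum (λ v → χᴮ (φ u) (φ v) * 1)       ≡⟨ sum-reindex (proj₁ iso) (λ y → χᴮ (φ u) y * 1) ⟩
    bookSum (λ y → χᴮ (φ u) y * 1)       ≡⟨ bookSum-χ (φ u) (const 1) ⟩
    neighbourSum (φ u) (const 1)         ≡⟨ neighbourSum-1 (φ u) ⟩
    bookDeg (φ u)                        ∎
    where open ≡-Reasoning

  deg-ψ : ∀ x → deg G (ψ x) ≡ bookDeg x
  deg-ψ x = trans (deg-φ (ψ x)) (cong bookDeg (φψ x))

  2≤deg : ∀ u → 2 ≤ deg G u
  2≤deg u = ≤-trans (2≤bookDeg (φ u)) (≤-reflexive (sym (deg-φ u)))
    where
    2≤bookDeg : ∀ x → 2 ≤ bookDeg x
    2≤bookDeg (spine _)  = 2≤n+1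
    2≤bookDeg (page _ _) = ≤-refl

  c₁ : [x^ 1 ] (da G) ≈ 2 ·y^ (n + 1) ⊕ (2 * n) ·y^ (2 * n)
  c₁ j = begin
    [x^ 1 ] (da G) j                                       ≡⟨ coefficient-1 G j ⟩
    sum (λ u → (1 ·y^ (N ∸ deg G u)) j)
      ≡⟨ sum-cong-≗ {N} (λ u → cong (λ e → (1 ·y^ (N ∸ e)) j) (deg-φ u)) ⟩
    sum (λ u → (1 ·y^ (N ∸ bookDeg (φ u))) j)
      ≡⟨ sum-reindex (proj₁ iso) (λ x → (1 ·y^ (N ∸ bookDeg x)) j) ⟩
    -- The unfolded `bookSum`: `X′` for each spine vertex, `Y′` for each page vertex.
    X′ + (X′ + (sum {n} (const Y′) + sum {n} (const Y′)))
      ≡⟨ cong (λ x → X′ + (X′ + (x + x))) (sum-const n Y′) ⟩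
    X′ + (X′ + (n * Y′ + n * Y′))                          ≡⟨ collect n X′ Y′ ⟩
    2 * X′ + 2 * n * Y′
      ≡⟨ cong₂ (λ d e → 2 * (1 ·y^ d) j + 2 * n * (1 ·y^ e) j) N∸[n+1] N∸2 ⟩
    2 * (1 ·y^ (n + 1)) j + 2 * n * (1 ·y^ (2 * n)) j
      ≡⟨ cong₂ _+_ (·y^-scale 2 (n + 1) j) (·y^-scale (2 * n) (2 * n) j) ⟨
    (2 ·y^ (n + 1) ⊕ (2 * n) ·y^ (2 * n)) j                ∎
    where
    open ≡-Reasoning
    X′ Y′ : ℕ
    X′ = (1 ·y^ (N ∸ (n + 1))) j
    Y′ = (1 ·y^ (N ∸ 2)) j
    collect : ∀ n x y → x + (x + (n * y + n * y)) ≡ 2 * x + 2 * n * y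
    collect = solve-∀
    N∸[n+1] : N ∸ (n + 1) ≡ n + 1
    N∸[n+1] = trans (cong (_∸ (n + 1)) (trans order (halves n))) (m+n∸n≡m (n + 1) (n + 1))
      where
      halves : ∀ n → 2 + (n + n) ≡ (n + 1) + (n + 1)
      halves = solve-∀
    N∸2 : N ∸ 2 ≡ 2 * n
    N∸2 = trans (cong (_∸ 2) order) (cong (n +_) (sym (+-identityʳ n)))

  -- Shown after doubling, as edges are summed over ordered pairs. The 2n + 1 edges meeting the
  -- spine have larger degree n + 1 and exponent n + 3; the `n` edges inside pages have both degrees
  -- 2 and exponent `N`.
  c₂ : [x^ 2 ] (da G) ≈ n ·y^ (2 * n + 2) ⊕ (2 * n + 1) ·y^ (n + 3)
  c₂ j = *-cancelˡ-≡ _ _ 2 (begin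
    2 * c                                                  ≡⟨ cong (c +_) (+-identityʳ c) ⟩
    c + c                                                  ≡⟨ coefficient-2 G j ⟩
    sum (λ u → sum λ v → adjacency G u v * (1 ·y^ ((2 + N) ∸ (deg G u ⊔ deg G v))) j)
      ≡⟨ sum-cong-≗ {N} (λ u → trans
           (sum-cong-≗ {N} (to-book u))
           (sum-reindex (proj₁ iso) (λ y → χᴮ (φ u) y * w (φ u) y))) ⟩
    sum (λ u → bookSum (λ y → χᴮ (φ u) y * w (φ u) y))
      ≡⟨ sum-reindex (proj₁ iso) (λ x → bookSum (λ y → χᴮ x y * w x y)) ⟩
    bookSum (λ x → bookSum (λ y → χᴮ x y * w x y))
      ≡⟨ bookSum-cong (λ x → trans (bookSum-χ x (w x)) (row x)) ⟩
    bookSum rowValue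
      ≡⟨ cong (λ s → X + n * X + (X + n * X + (s + s))) (sum-const n (X + Y)) ⟩
    X + n * X + (X + n * X + (n * (X + Y) + n * (X + Y)))  ≡⟨ collect n X Y ⟩
    2 * (n * Y + (2 * n + 1) * X)
      ≡⟨ cong (2 *_) (cong₂ _+_ (·y^-scale n (2 * n + 2) j) (·y^-scale (2 * n + 1) (n + 3) j)) ⟨
    2 * (n ·y^ (2 * n + 2) ⊕ (2 * n + 1) ·y^ (n + 3)) j    ∎)
    where
    open ≡-Reasoning
    c X Y : ℕ
    c = [x^ 2 ] (da G) j
    X = (1 ·y^ (n + 3)) j
    Y = (1 ·y^ (2 * n + 2)) j
    w : BookVertex n → BookVertex n → ℕ
    w x y = (1 ·y^ ((2 + N) ∸ (bookDeg x ⊔ bookDeg y))) j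
    to-book : ∀ u v → adjacency G u v * (1 ·y^ ((2 + N) ∸ (deg G u ⊔ deg G v))) j ≡
                      χᴮ (φ u) (φ v) * w (φ u) (φ v)
    to-book u v = cong₂ _*_ (adjacency-φ u v)
      (cong₂ (λ d e → (1 ·y^ ((2 + N) ∸ (d ⊔ e))) j) (deg-φ u) (deg-φ v))
    heavy : (2 + N) ∸ (n + 1) ≡ n + 3
    heavy = trans (cong (_∸ (n + 1)) (trans (cong (2 +_) order) (split n))) (m+n∸n≡m (n + 3) (n + 1))
      where
      split : ∀ n → 4 + (n + n) ≡ (n + 3) + (n + 1)
      split = solve-∀
    w-heavy : ∀ {d} → d ≡ n + 1 → (1 ·y^ ((2 + N) ∸ d)) j ≡ X
    w-heavy refl = cong (λ e → (1 ·y^ e) j) heavy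
    w-spine : ∀ s t → w (spine s) (spine t) ≡ X
    w-spine s t = w-heavy (⊔-idem (n + 1))
    w-spine-page : ∀ s i t → w (spine s) (page i t) ≡ X
    w-spine-page s i t = w-heavy (m≥n⇒m⊔n≡m 2≤n+1)
    w-page-spine : ∀ s i t → w (page i t) (spine s) ≡ X
    w-page-spine s i t = w-heavy (m≤n⇒m⊔n≡n 2≤n+1)
    w-page : ∀ i s k t → w (page i s) (page k t) ≡ Y
    w-page i s k t = cong (λ e → (1 ·y^ e) j) (trans order (light n))
      where
      light : ∀ n → 2 + (n + n) ≡ 2 * n + 2
      light = solve-∀
    -- The edges at one vertex: n + 1 of weight `X` at a spine vertex; at a page vertex one to the
    -- spine and one inside the page.
    rowValue : BookVertex n → ℕ
    rowValue (spine _)  = X + n * X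
    rowValue (page _ _) = X + Y
    row : ∀ x → neighbourSum x (w x) ≡ rowValue x
    row (spine a)  = cong₂ _+_ (w-spine a b) (trans (sum-cong-≗ {n} λ i → w-spine-page a i a) (sum-const n X))
    row (spine b)  = cong₂ _+_ (w-spine b a) (trans (sum-cong-≗ {n} λ i → w-spine-page b i b) (sum-const n X))
    row (page i a) = cong₂ _+_ (w-page-spine a i a) (w-page i a i b)
    row (page i b) = cong₂ _+_ (w-page-spine b i b) (w-page i b i a)
    collect : ∀ n x y → x + n * x + (x + n * x + (n * (x + y) + n * (x + y))) ≡
                        2 * (n * y + (2 * n + 1) * x)
    collect = solve-∀

  -- The spine vertex on side `s` is the root. The other spine vertex and the near ends of pages are
  -- adjacent to it; a far end goes through the near end of its page or through the other spine
  -- vertex, whichever `detour` provides.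
  admissible-around : ∀ {S} s → ψ (spine s) ∈ S →
    (∀ i → ψ (page i s) ∈ S ⊎ ψ (spine (opp s)) ∈ S) → Admissible G S
  admissible-around {S} s s∈ detour = root⇒admissible G s∈ λ {w} w∈ →
    subst (λ u → Path G S u (ψ (spine s))) (ψφ w) (reach (φ w) (subst (_∈ S) (sym (ψφ w)) w∈))
    where
    one : ∀ {x} → Adj (Book n) (spine s) x → ψ x ∈ S → Path G S (ψ x) (ψ (spine s))
    one e x∈ = path-cons G x∈ (~-sym G (adj-ψ e)) (path-refl G s∈)
    reach-far : ∀ i → ψ (page i (opp s)) ∈ S → Path G S (ψ (page i (opp s))) (ψ (spine s))
    reach-far i far∈ with detour i
    ... | inj₁ near∈ = path-cons G far∈ (~-sym G (adj-ψ (page-page i s))) (one (spine-page i s) near∈)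
    ... | inj₂ opp∈  = path-cons G far∈ (~-sym G (adj-ψ (spine-page i (opp s)))) (one (spine-spine s) opp∈)
    same-or-opp : ∀ t → t ≡ s ⊎ t ≡ opp s
    same-or-opp t = go s t
      where
      go : ∀ s t → t ≡ s ⊎ t ≡ opp s
      go a a = inj₁ refl
      go a b = inj₂ refl
      go b a = inj₂ refl
      go b b = inj₁ refl
    reach : ∀ x → ψ x ∈ S → Path G S (ψ x) (ψ (spine s))
    reach (spine t) t∈ with same-or-opp t
    ... | inj₁ refl = path-refl G s∈
    ... | inj₂ refl = one (spine-spine s) t∈
    reach (page i t) t∈ with same-or-opp t
    ... | inj₁ refl = one (spine-page i s) t∈
    ... | inj₂ refl = reach-far i t∈

  -- If a spine vertex is removed, the other one is the root and all near page ends survive; if a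
  -- page vertex is removed, the whole spine survives.
  coatom-admissible : ∀ v → Admissible G (∁ ⁅ v ⁆)
  coatom-admissible v = around (φ v) refl
    where
    avoids : ∀ {x} → φ v ≢ x → ψ x ∈ ∁ ⁅ v ⁆
    avoids {x} ne = x∉p⇒x∈∁p (x≢y⇒x∉⁅y⁆ λ ψx≡v → ne (trans (cong φ (sym ψx≡v)) (φψ x)))
    avoids′ : ∀ {x y} → φ v ≡ y → y ≢ x → ψ x ∈ ∁ ⁅ v ⁆
    avoids′ refl = avoids
    around : ∀ x → φ v ≡ x → Admissible G (∁ ⁅ v ⁆)
    around (spine a)  eq = admissible-around b (avoids′ eq λ ()) λ i → inj₁ (avoids′ eq λ ())
    around (spine b)  eq = admissible-around a (avoids′ eq λ ()) λ i → inj₁ (avoids′ eq λ ())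
    around (page i s) eq = admissible-around a (avoids′ eq λ ()) λ k → inj₂ (avoids′ eq λ ())

  -- The neighbour is always a page vertex; next to a spine vertex one exists because `n` is
  -- positive. It attains the minimum in `f-coatom`.
  page-neighbour : ∀ v → ∃[ w ] (Adj G v w × deg G w ≡ 2)
  page-neighbour v with φ v in eq
  ... | spine s  = ψ (page (fromℕ< 1≤n) s) ,
                   subst (λ u → Adj G u _) (trans (cong ψ (sym eq)) (ψφ v)) (adj-ψ (spine-page _ s)) , deg-ψ _
  ... | page i s = ψ (page i (opp s)) ,
                   subst (λ u → Adj G u _) (trans (cong ψ (sym eq)) (ψφ v)) (adj-ψ (page-page i s)) , deg-ψ _

  -- Removing `v` costs a vertex at most one neighbour, and all degrees are at least 2, so every
  -- score is at least `N`. A degree 2 neighbour of `v` has one neighbour on either side and scores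
  -- exactly `N`.
  f-coatom : ∀ v → f G (∁ ⁅ v ⁆) ≡ N
  f-coatom v with page-neighbour v
  ... | w , v~w , deg≡2 = f-≡ G w∈ score≡N (λ {u} _ → lower u)
    where
    w∈ : w ∈ ∁ ⁅ v ⁆
    w∈ = x∉p⇒x∈∁p (x≢y⇒x∉⁅y⁆ λ { refl → irrefl G v~w })
    χ≡1 : adjacency G w v ≡ 1
    χ≡1 = adjacency-1 G (~-sym G v~w)
    δ≡1 : δ G (∁ ⁅ v ⁆) w ≡ 1
    δ≡1 = +-cancelʳ-≡ 1 _ _ (trans (cong (δ G (∁ ⁅ v ⁆) w +_) (sym χ≡1)) (trans (δ-coatom G w v) deg≡2))
    score≡N : score G (∁ ⁅ v ⁆) w ≡ N
    score≡N = trans (score-coatom G w v) (cong₂ (λ x y → (x + N) ∸ y) δ≡1 χ≡1)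
    lower : ∀ u → N ≤ score G (∁ ⁅ v ⁆) u
    lower u = begin
      N                                              ≡⟨ m+n∸m≡n χ N ⟨
      (χ + N) ∸ χ                                    ≤⟨ ∸-monoˡ-≤ χ (+-monoˡ-≤ N χ≤δ) ⟩
      (δ G (∁ ⁅ v ⁆) u + N) ∸ χ                      ≡⟨ score-coatom G u v ⟨
      score G (∁ ⁅ v ⁆) u                            ∎
      where
      open ≤-Reasoning
      χ : ℕ
      χ = adjacency G u v
      χ≤δ : χ ≤ δ G (∁ ⁅ v ⁆) u
      χ≤δ = +-cancelʳ-≤ χ _ _ (begin
        χ + χ                      ≤⟨ +-mono-≤ (adjacency-≤1 G u v) (adjacency-≤1 G u v) ⟩
        2                          ≤⟨ 2≤deg u ⟩
        deg G u                    ≡⟨ δ-coatom G u v ⟨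
        δ G (∁ ⁅ v ⁆) u + χ        ∎)

  c₃ : [x^ 2 * n + 1 ] (da G) ≈ (2 * n + 2) ·y^ (2 * n + 2)
  c₃ j = begin
    [x^ 2 * n + 1 ] (da G) j
      ≡⟨ coefficient-coatom G (trans (size n) (sym order)) j ⟩
    sum (λ v → weight G j (∁ ⁅ v ⁆))
      ≡⟨ sum-cong-≗ {N} (λ v → trans (weight-yes G (coatom-admissible v)) (cong (λ e → (1 ·y^ e) j) (f-coatom v))) ⟩
    sum {N} (const ((1 ·y^ N) j))                ≡⟨ sum-const N _ ⟩
    N * (1 ·y^ N) j                              ≡⟨ ·y^-scale N N j ⟨
    (N ·y^ N) j
      ≡⟨ cong (λ m → (m ·y^ m) j) (trans order (size′ n)) ⟩
    ((2 * n + 2) ·y^ (2 * n + 2)) j              ∎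
    where
    open ≡-Reasoning
    size : ∀ n → suc (2 * n + 1) ≡ 2 + (n + n)
    size = solve-∀
    size′ : ∀ n → 2 + (n + n) ≡ 2 * n + 2
    size′ = solve-∀

  -- No neighbour lies outside the full set, so the minimum is `N` plus the smallest degree, which
  -- is 2, attained on a page.
  f-⊤ : f G ⊤ ≡ 2 + N
  f-⊤ = f-≡ G ∈⊤ (trans (score-⊤ G page₀) (cong (_+ N) (deg-ψ (page (fromℕ< 1≤n) a))))
    λ {u} _ → ≤-trans (+-monoˡ-≤ N (2≤deg u)) (≤-reflexive (sym (score-⊤ G u)))
    where
    page₀ : Fin N
    page₀ = ψ (page (fromℕ< 1≤n) a)

  c₄ : [x^ 2 * n + 2 ] (da G) ≈ 1 ·y^ (2 * n + 4)
  c₄ j = begin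
    [x^ 2 * n + 2 ] (da G) j     ≡⟨ coefficient-full G (trans (size n) (sym order)) j ⟩
    weight G j ⊤                 ≡⟨ weight-yes G (admissible-around a ∈⊤ λ _ → inj₁ ∈⊤) ⟩
    (1 ·y^ f G ⊤) j
      ≡⟨ cong (λ e → (1 ·y^ e) j) (trans f-⊤ (trans (cong (2 +_) order) (size′ n))) ⟩
    (1 ·y^ (2 * n + 4)) j        ∎
    where
    open ≡-Reasoning
    size : ∀ n → 2 * n + 2 ≡ 2 + (n + n)
    size = solve-∀
    size′ : ∀ n → 4 + (n + n) ≡ 2 * n + 4
    size′ = solve-∀

proposition40 : (n : ℕ) .{{_ : NonZero n}} (N : ℕ) .{{_ : NonZero N}} (G : SimpleGraph (Fin N)) →
    (G ≅ Book n) ⇔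
    ( ([x^ 1 ] (da G) ≈ 2 ·y^ (n + 1) ⊕ (2 * n) ·y^ (2 * n))
    × ([x^ 2 ] (da G) ≈ n ·y^ (2 * n + 2) ⊕ (2 * n + 1) ·y^ (n + 3))
    × ([x^ 2 * n + 1 ] (da G) ≈ (2 * n + 2) ·y^ (2 * n + 2))
    × ([x^ 2 * n + 2 ] (da G) ≈ 1 ·y^ (2 * n + 4)))
proposition40 n N G = mk⇔ (λ (iso : G ≅ Book n) → let open FromBook G iso in c₁ , c₂ , c₃ , c₄)
  λ (c₁ , _ , c₃ , _) → coefficients⇒book n G c₁ c₃
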